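{- For $n\ge1$ let $G(n)$ be the number of ordinary partitions of $n$ into parts congruent to $\pm2,\pm3,\pm4,\pm5$ modulo $16$. Let $H(n)$ be the number of partitions of $n$ with $n$ copies of $n$ such that (i) every part $m_j$ has even subscript $j$, (ii) with parts in ascending lexicographic order, the weighted difference between each part and the preceding one is $\ge0$, and (iii) there is no pair of consecutive parts $a_i\le b_j$ (in this order) with $a$ and $b$ both odd and $((b_j-a_i))=0$. Then $G(n)=H(n)$.
   Context: $M=\{m_i: 1\le i\le m\}$; a partition with $n$ copies of $n$ is a finite multiset of elements of $M$ whose values (first entries) sum to the number partitioned. Lexicographic order: $m_i>n_j$ iff $m>n$, or $m=n$ and $i>j$. Weighted difference $((m_i-n_j))=m-n-i-j$. -}

module Defs where

open import Level using (Level; _⊔_)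
open import Data.Nat using (ℕ; zero; suc; _+_; _≤_; _<_; z≤n; s≤s; _≟_; _≤?_; _<?_)
open import Data.Nat.Properties using (≤-trans; m≤m+n; m≤n+m; +-mono-≤)
open import Data.Nat.Divisibility as ℕᵈ using (_∣?_)
open import Data.Integer as ℤ using (ℤ; +_; 0ℤ)
open import Data.Integer.Divisibility as ℤᵈ using ()
open import Data.List using (List; []; _∷_; length; map; filter; upTo; cartesianProduct; cartesianProductWith)
open import Data.Nat.ListAction using (sum)
open import Data.List.Properties using (∷-injective; length-map)
open import Data.List.Membership.Propositional using (_∈_)
open import Data.List.Membership.Propositional.Properties
  using (∈-filter⁺; ∈-filter⁻; ∈-cartesianProductWith⁺; ∈-cartesianProductWith⁻; ∈-cartesianProduct⁺; ∈-upTo⁺)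
open import Data.List.Relation.Unary.All as All using (All; []; _∷_; all?)
open import Data.List.Relation.Unary.All.Properties using (map⁺; map⁻)
open import Data.List.Relation.Unary.Any using (Any; here; there; any?)
open import Data.List.Relation.Unary.AllPairs using ([]; _∷_)
open import Data.List.Relation.Unary.Linked using (Linked; linked?)
open import Data.List.Relation.Unary.Unique.Propositional using (Unique)
open import Data.List.Relation.Unary.Unique.Propositional.Properties
  using (filter⁺; cartesianProductWith⁺; cartesianProduct⁺; upTo⁺)
open import Data.Product using (_×_; _,_; proj₁; proj₂)
open import Data.Product.Relation.Binary.Lex.Strict using (×-Lex; ×-decidable)
open import Data.Sum using (_⊎_)
open import Function using (_⇔_; mk⇔; _∘_)
open import Relation.Binary using (Rel)
open import Relation.Binary.PropositionalEquality using (_≡_; refl; subst)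
open import Relation.Nullary using (¬_; ¬?; _×-dec_; _⊎-dec_; map′)
open import Relation.Unary using (Pred; Decidable)

private
  variable
    a p : Level
    A : Set a

-- A finite multiset of numbers is represented by its ascending list.
record IsPartition (n : ℕ) (π : List ℕ) : Set where
  constructor mkPartition
  field
    positive  : All (1 ≤_) π
    ascending : Linked _≤_ π
    total     : sum π ≡ n

infix 4 _≡_[mod_] _≡±_[mod_] _≼_

_≡_[mod_] : ℤ → ℤ → ℕ → Set
x ≡ y [mod m ] = (+ m) ℤᵈ.∣ (x ℤ.- y)

_≡±_[mod_] : ℕ → ℕ → ℕ → Set
k ≡± r [mod m ] = (+ k) ≡ (+ r) [mod m ] ⊎ (+ k) ≡ (ℤ.- (+ r)) [mod m ]

record IsGPartition (n : ℕ) (π : List ℕ) : Set where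
  constructor mkGPartition
  field
    isPartition : IsPartition n π
    residues    : All (λ k → Any (λ r → k ≡± r [mod 16 ]) (2 ∷ 3 ∷ 4 ∷ 5 ∷ [])) π

-- The pair (m , i) stands for mᵢ; only the pairs satisfying InM lie in M.
Part : Set
Part = ℕ × ℕ

value subscript : Part → ℕ
value     = proj₁
subscript = proj₂

InM : Pred Part _
InM x = 1 ≤ subscript x × subscript x ≤ value x

_≼_ : Rel Part _
_≼_ = ×-Lex _≡_ _<_ _≤_

⟪_-_⟫ : Part → Part → ℤ
⟪ (m , i) - (n , j) ⟫ = + m ℤ.- + n ℤ.- + i ℤ.- + j

Even Odd : ℕ → Set
Even k = 2 ℕᵈ.∣ k
Odd  k = ¬ Even k

record IsCopyPartition (n : ℕ) (π : List Part) : Set where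
  constructor mkCopyPartition
  field
    inM       : All InM π
    ascending : Linked _≼_ π
    total     : sum (map value π) ≡ n

-- In the Linked conditions the first argument x precedes the second, y.
record IsHPartition (n : ℕ) (π : List Part) : Set where
  constructor mkHPartition
  field
    isCopyPartition : IsCopyPartition n π
    evenSubscripts  : All (Even ∘ subscript) π
    differences     : Linked (λ x y → 0ℤ ℤ.≤ ⟪ y - x ⟫) π
    noOddZero       : Linked (λ x y → ¬ (Odd (value x) × Odd (value y) × ⟪ y - x ⟫ ≡ 0ℤ)) π

-- P has exactly count many elements: they are listed without omission or repetition.
record Enumeration {A : Set a} (P : Pred A p) : Set (a ⊔ p) where
  field
    elements : List A
    unique   : Unique elements
    exact    : ∀ x → x ∈ elements ⇔ P x

  count : ℕ
  count = length elements

listsUpTo : List A → ℕ → List (List A)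
listsUpTo as zero    = [] ∷ []
listsUpTo as (suc k) = [] ∷ cartesianProductWith _∷_ as (listsUpTo as k)

listsUpTo-unique : {as : List A} → Unique as → ∀ k → Unique (listsUpTo as k)
listsUpTo-unique      as! zero    = [] ∷ []
listsUpTo-unique {as = as} as! (suc k) =
  All.tabulate ([]∉ _) ∷ cartesianProductWith⁺ _∷_ ∷-injective as! (listsUpTo-unique as! k)
  where
  []∉ : ∀ xs → xs ∈ cartesianProductWith _∷_ as (listsUpTo as k) → ¬ ([] ≡ xs)
  []∉ xs xs∈ refl with ∈-cartesianProductWith⁻ _∷_ as (listsUpTo as k) xs∈
  ... | _ , _ , _ , _ , ()

∈-listsUpTo : ∀ {as : List A} k {xs} → All (_∈ as) xs → length xs ≤ k → xs ∈ listsUpTo as k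
∈-listsUpTo zero    []         _         = here refl
∈-listsUpTo (suc k) []         _         = here refl
∈-listsUpTo (suc k) (x∈ ∷ xs∈) (s≤s len) =
  there (∈-cartesianProductWith⁺ _∷_ x∈ (∈-listsUpTo k xs∈ len))

enumerateLists : {P : Pred (List A) p} → Decidable P → {as : List A} → Unique as → (k : ℕ) →
                 (∀ {xs} → P xs → All (_∈ as) xs × length xs ≤ k) → Enumeration P
enumerateLists P? {as} as! k bounded = record
  { elements = filter P? (listsUpTo as k)
  ; unique   = filter⁺ P? (listsUpTo-unique as! k)
  ; exact    = λ xs → mk⇔
      (λ xs∈ → proj₂ (∈-filter⁻ P? {xs = listsUpTo as k} xs∈))
      (λ Pxs → ∈-filter⁺ P? (∈-listsUpTo k (proj₁ (bounded Pxs)) (proj₂ (bounded Pxs))) Pxs)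
  }

length≤sum : ∀ {xs} → All (1 ≤_) xs → length xs ≤ sum xs
length≤sum []         = z≤n
length≤sum (1≤x ∷ ps) = +-mono-≤ 1≤x (length≤sum ps)

all≤sum : ∀ xs → All (_≤ sum xs) xs
all≤sum []       = []
all≤sum (x ∷ xs) = m≤m+n x (sum xs) ∷ All.map (λ le → ≤-trans le (m≤n+m (sum xs) x)) (all≤sum xs)

isPartition? : ∀ n → Decidable (IsPartition n)
isPartition? n π = map′ (λ (x , y , z) → mkPartition x y z)
                        (λ (mkPartition x y z) → x , y , z)
  (all? (1 ≤?_) π ×-dec linked? _≤?_ π ×-dec (sum π ≟ n))

isGPartition? : ∀ n → Decidable (IsGPartition n)
isGPartition? n π = map′ (λ (x , y) → mkGPartition x y)
                         (λ (mkGPartition x y) → x , y)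
  (isPartition? n π ×-dec all? (λ k → any? (λ r → (_ ∣? _) ⊎-dec (_ ∣? _)) _) π)

isCopyPartition? : ∀ n → Decidable (IsCopyPartition n)
isCopyPartition? n π = map′ (λ (x , y , z) → mkCopyPartition x y z)
                            (λ (mkCopyPartition x y z) → x , y , z)
  (all? (λ x → (1 ≤? subscript x) ×-dec (subscript x ≤? value x)) π
   ×-dec linked? (×-decidable _≟_ _<?_ _≤?_) π
   ×-dec (sum (map value π) ≟ n))

isHPartition? : ∀ n → Decidable (IsHPartition n)
isHPartition? n π = map′ (λ (x , y , z , w) → mkHPartition x y z w)
                         (λ (mkHPartition x y z w) → x , y , z , w)
  (isCopyPartition? n π
   ×-dec all? (λ x → 2 ∣? subscript x) π
   ×-dec linked? (λ x y → 0ℤ ℤ.≤? ⟪ y - x ⟫) π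
   ×-dec linked? (λ x y → ¬? (¬? (2 ∣? value x) ×-dec ¬? (2 ∣? value y) ×-dec (⟪ y - x ⟫ ℤ.≟ 0ℤ))) π)

gPartitions : ∀ n → Enumeration (IsGPartition n)
gPartitions n = enumerateLists (isGPartition? n) (upTo⁺ (suc n)) n bounded
  where
  bounded : ∀ {π} → IsGPartition n π → All (_∈ upTo (suc n)) π × length π ≤ n
  bounded {π} (mkGPartition (mkPartition pos _ refl) _) =
    All.map (∈-upTo⁺ ∘ s≤s) (all≤sum π) , length≤sum pos

hPartitions : ∀ n → Enumeration (IsHPartition n)
hPartitions n =
  enumerateLists (isHPartition? n) (cartesianProduct⁺ (upTo⁺ (suc n)) (upTo⁺ (suc n))) n bounded
  where
  bounded : ∀ {π} → IsHPartition n π →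
            All (_∈ cartesianProduct (upTo (suc n)) (upTo (suc n))) π × length π ≤ n
  bounded {π} (mkHPartition (mkCopyPartition inM _ refl) _ _ _) =
    All.zipWith (λ ((_ , i≤m) , m≤n) →
                   ∈-cartesianProduct⁺ (∈-upTo⁺ (s≤s m≤n)) (∈-upTo⁺ (s≤s (≤-trans i≤m m≤n))))
                (inM , map⁻ (all≤sum (map value π))) ,
    subst (_≤ sum (map value π)) (length-map value π)
      (length≤sum (map⁺ (All.map (λ (1≤i , i≤m) → ≤-trans 1≤i i≤m) inM)))

G H : ℕ → ℕ
G n = Enumeration.count (gPartitions n)
H n = Enumeration.count (hPartitions n)

{-# OPTIONS --safe #-}

-- An even-subscripted part m_i is a pair of odd numbers a < b with a + b = 2m, and conditions (ii) and
-- (iii) say exactly that consecutive pairs do not overlap. So H(n) counts the partitions of 2n into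
-- distinct odd parts. Sorting these parts by residue modulo 4, the triple product turns them into a
-- charge c together with an unrestricted partition λ, of total weight 2c² - c + 4|λ|, and evenness of
-- the total means c = 2k: hence n = 4k² - k + 2|λ|. Removing the parts divisible by 8 from 2λ and
-- applying the triple product backwards to them and to the charge k gives distinct parts ≡ ±3 (mod 8).
-- The rest of 2λ is ≡ 2, 4, 6 (mod 8); its parts ≡ ±6 (mod 16) are doubled parts ≡ ±3 (mod 8), and
-- writing multiplicities as 2f + e with e ∈ {0 , 1} makes the parts ≡ ±3 (mod 8) unrestricted. What
-- remains are the parts counted by G(n).

module Submission where

open import Defs
open import Level using (0ℓ)
open import Data.Bool using (Bool; true; false)
open import Data.Integer as ℤ using (ℤ; +_; -[1+_]; 0ℤ)
import Data.Integer.Divisibility.Signed as Signed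
import Data.Integer.Properties as ℤ
open import Data.Integer.Tactic.RingSolver using (solve-∀)
open import Data.List using (List; []; _∷_; length; map; filter; upTo)
open import Data.List.Membership.Propositional using (_∈_)
open import Data.List.Membership.Propositional.Properties using (∈-map⁺; ∈-map⁻; ∈-upTo⁺)
open import Data.List.Membership.Propositional.Properties.WithK using (unique∧set⇒bag)
open import Data.List.Properties using (filter-all; filter-none; filter-accept; filter-reject; length-map)
open import Data.List.Relation.Binary.BagAndSetEquality using (∼bag⇒↭)
open import Data.List.Relation.Binary.Permutation.Propositional.Properties using (↭-length)
open import Data.List.Relation.Unary.All as All using (All; []; _∷_; all?)
import Data.List.Relation.Unary.All.Properties as All
open import Data.List.Relation.Unary.AllPairs as AllPairs using (AllPairs; []; _∷_)
import Data.List.Relation.Unary.AllPairs.Properties as AllPairs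
open import Data.List.Relation.Unary.Any as Any using (Any; here; there)
open import Data.List.Relation.Unary.Linked as Linked using (Linked; []; [-]; _∷_)
open import Data.List.Relation.Unary.Linked.Properties using (Linked⇒AllPairs; AllPairs⇒Linked)
open import Data.List.Relation.Unary.Unique.Propositional using (Unique)
open import Data.Nat
  using (ℕ; zero; suc; _+_; _∸_; _*_; _≤_; _<_; _≥_; s≤s; z≤n; _≤?_; _<?_; _≟_; _%_; _/_; NonZero; >-nonZero⁻¹)
open import Data.List.Membership.DecPropositional _≟_ using (_∈?_)
open import Data.Nat.Divisibility using (_∣?_; divides; m∣m*n; n∣m*n)
open import Data.Nat.DivMod using (m*n/n≡m; +-distrib-/-∣ʳ; m≡m%n+[m/n]*n; [m+kn]%n≡m%n; m<n⇒m%n≡m; m%n*o≡m*o%[n*o])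
open import Data.Nat.Induction using (<-rec)
open import Data.Nat.ListAction using (sum)
import Data.Nat.Properties as ℕ
open import Data.Nat.Solver using (module +-*-Solver)
open import Data.Product using (_×_; _,_; proj₁; proj₂; ∃-syntax; uncurry)
open import Data.Sum as Sum using (_⊎_; inj₁; inj₂)
open import Data.Unit using (⊤)
open import Function using (_∘_; id; mk⇔; Equivalence)
open import Relation.Binary using (Rel; Setoid)
open import Relation.Binary.PropositionalEquality
import Relation.Binary.Reasoning.Setoid as SetoidReasoning
open import Relation.Nullary using (¬_; ¬?; yes; no; contradiction; map′; _×-dec_; _⊎-dec_; _→-dec_)
open import Relation.Nullary.Decidable using (from-yes; from-no)
open import Relation.Unary using (Pred; Decidable)

-- Each factor of a generating function becomes a class of objects with a weight, and each identity
-- a weight-preserving bijection. Infinite products are thus compared without power series, and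
-- counting happens only at the end, in a single weight. The conditions on an object stay outside
-- its carrier, in `Ok`, and the inverse laws are asked only where `Ok` holds, so equality of
-- objects never involves equality of proofs. On sorted lists the triple product is awkward, since
-- every move of the origin would have to preserve order and residue. Recording gaps removes these
-- side conditions: every list of naturals is admissible, and a move touches only the head of a
-- list. Two odd numbers replacing m_i have sum 2m, so the natural weight on that side is 2n.
-- Instead of dividing, both sides are doubled; they meet in `double (J₈.charges ⊗ gaps 2 0 2)`.

-- Weighted classes and weight-preserving bijections.

-- The weights are integers so that charges, which may be negative, need no special treatment.
record Class : Set₁ where
  no-eta-equality
  field
    Carrier : Set
    Ok      : Pred Carrier 0ℓ
    wt      : Carrier → ℤ

infix 4 _≃_

record _≃_ (A B : Class) : Set where
  private
    module A = Class A
    module B = Class B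
  field
    to      : A.Carrier → B.Carrier
    from    : B.Carrier → A.Carrier
    to-ok   : ∀ {x} → A.Ok x → B.Ok (to x)
    from-ok : ∀ {y} → B.Ok y → A.Ok (from y)
    from-to : ∀ {x} → A.Ok x → from (to x) ≡ x
    to-from : ∀ {y} → B.Ok y → to (from y) ≡ y
    wt-to   : ∀ {x} → A.Ok x → B.wt (to x) ≡ A.wt x

  wt-from : ∀ {y} → B.Ok y → A.wt (from y) ≡ B.wt y
  wt-from ok = trans (sym (wt-to (from-ok ok))) (cong B.wt (to-from ok))

open _≃_

≃-refl : ∀ {A} → A ≃ A
≃-refl = record
  { to = id ; from = id ; to-ok = id ; from-ok = id
  ; from-to = λ _ → refl ; to-from = λ _ → refl ; wt-to = λ _ → refl }

≃-sym : ∀ {A B} → A ≃ B → B ≃ A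
≃-sym f = record
  { to = from f ; from = to f ; to-ok = from-ok f ; from-ok = to-ok f
  ; from-to = to-from f ; to-from = from-to f ; wt-to = wt-from f }

≃-trans : ∀ {A B C} → A ≃ B → B ≃ C → A ≃ C
≃-trans f g = record
  { to = to g ∘ to f ; from = from f ∘ from g
  ; to-ok = to-ok g ∘ to-ok f ; from-ok = from-ok f ∘ from-ok g
  ; from-to = λ ok → trans (cong (from f) (from-to g (to-ok f ok))) (from-to f ok)
  ; to-from = λ ok → trans (cong (to g) (to-from f (from-ok g ok))) (to-from g ok)
  ; wt-to = λ ok → trans (wt-to g (to-ok f ok)) (wt-to f ok) }

≃-setoid : Setoid _ _
≃-setoid = record
  { Carrier = Class ; _≈_ = _≃_
  ; isEquivalence = record { refl = ≃-refl ; sym = ≃-sym ; trans = ≃-trans } }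

infixr 5 _⊗_

_⊗_ : Class → Class → Class
(A ⊗ B) .Class.Carrier    = Class.Carrier A × Class.Carrier B
(A ⊗ B) .Class.Ok (x , y) = Class.Ok A x × Class.Ok B y
(A ⊗ B) .Class.wt (x , y) = Class.wt A x ℤ.+ Class.wt B y

⊗-cong : ∀ {A A′ B B′} → A ≃ A′ → B ≃ B′ → A ⊗ B ≃ A′ ⊗ B′
⊗-cong f g = record
  { to = λ (x , y) → to f x , to g y
  ; from = λ (x , y) → from f x , from g y
  ; to-ok = λ (p , q) → to-ok f p , to-ok g q
  ; from-ok = λ (p , q) → from-ok f p , from-ok g q
  ; from-to = λ (p , q) → cong₂ _,_ (from-to f p) (from-to g q)
  ; to-from = λ (p , q) → cong₂ _,_ (to-from f p) (to-from g q)
  ; wt-to = λ (p , q) → cong₂ ℤ._+_ (wt-to f p) (wt-to g q) }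

⊗-assoc : ∀ {A B C} → (A ⊗ B) ⊗ C ≃ A ⊗ (B ⊗ C)
⊗-assoc {A} {B} {C} = record
  { to = λ ((x , y) , z) → x , y , z
  ; from = λ (x , y , z) → (x , y) , z
  ; to-ok = λ ((p , q) , r) → p , q , r
  ; from-ok = λ (p , q , r) → (p , q) , r
  ; from-to = λ _ → refl
  ; to-from = λ _ → refl
  ; wt-to = λ {((x , y) , z)} _ → sym (ℤ.+-assoc (Class.wt A x) (Class.wt B y) (Class.wt C z)) }

double : Class → Class
double A = record { Carrier = Class.Carrier A ; Ok = Class.Ok A ; wt = λ x → + 2 ℤ.* Class.wt A x }

double-cong : ∀ {A B} → A ≃ B → double A ≃ double B
double-cong f = record
  { to = to f ; from = from f ; to-ok = to-ok f ; from-ok = from-ok f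
  ; from-to = from-to f ; to-from = to-from f ; wt-to = λ ok → cong (+ 2 ℤ.*_) (wt-to f ok) }

Evenℤ : ℤ → Set
Evenℤ z = ∃[ k ] z ≡ + 2 ℤ.* k

-- For lists of odd parts, even weight means an even number of parts, which is what grouping them
-- into pairs requires.
evenPart : Class → Class
evenPart A = record
  { Carrier = Class.Carrier A
  ; Ok = λ x → Class.Ok A x × Evenℤ (Class.wt A x)
  ; wt = Class.wt A }

evenPart-cong : ∀ {A B} → A ≃ B → evenPart A ≃ evenPart B
evenPart-cong f = record
  { to = to f ; from = from f
  ; to-ok = λ (ok , k , e) → to-ok f ok , k , trans (wt-to f ok) e
  ; from-ok = λ (ok , k , e) → from-ok f ok , k , trans (wt-from f ok) e
  ; from-to = from-to f ∘ proj₁ ; to-from = to-from f ∘ proj₁ ; wt-to = wt-to f ∘ proj₁ }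

fibre : (A : Class) → ℤ → Pred (Class.Carrier A) 0ℓ
fibre A n x = Class.Ok A x × Class.wt A x ≡ n

-- Mapping the first listing along `to f` gives a duplicate-free list with the same members as the
-- second, hence a permutation of it. Since `to f` is injective only on `Ok` elements, `unique-map`
-- carries membership along.
≃⇒count≡ : ∀ {A B n} → A ≃ B → (EA : Enumeration (fibre A n)) (EB : Enumeration (fibre B n)) →
           Enumeration.count EA ≡ Enumeration.count EB
≃⇒count≡ {A} {B} {n} f EA EB =
  trans (sym (length-map (to f) EA.elements))
        (↭-length (∼bag⇒↭ (unique∧set⇒bag (unique-map EA.elements (λ x∈ → inA x∈) EA.unique)
                                           EB.unique (mk⇔ ⇒ ⇐))))
  where
  module EA = Enumeration EA
  module EB = Enumeration EB
  module A = Class A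
  module B = Class B

  inA : ∀ {x} → x ∈ EA.elements → fibre A n x
  inA {x} = Equivalence.to (EA.exact x)

  unique-map : ∀ xs → (∀ {x} → x ∈ xs → fibre A n x) → Unique xs → Unique (map (to f) xs)
  unique-map []       _  []         = []
  unique-map (x ∷ xs) ok (x∉ ∷ xs!) =
    All.map⁺ (All.tabulate λ {y} y∈ e → All.lookup x∉ y∈
      (trans (sym (from-to f (proj₁ (ok (here refl)))))
             (trans (cong (from f) e) (from-to f (proj₁ (ok (there y∈)))))))
    ∷ unique-map xs (ok ∘ there) xs!

  ⇒ : ∀ {y} → y ∈ map (to f) EA.elements → y ∈ EB.elements
  ⇒ y∈ with ∈-map⁻ (to f) y∈
  ... | x , x∈ , refl = Equivalence.from (EB.exact (to f x))
    (to-ok f (proj₁ (inA x∈)) , trans (wt-to f (proj₁ (inA x∈))) (proj₂ (inA x∈)))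

  ⇐ : ∀ {y} → y ∈ EB.elements → y ∈ map (to f) EA.elements
  ⇐ {y} y∈ with Equivalence.to (EB.exact y) y∈
  ... | ok , e = subst (_∈ _) (to-from f ok) (∈-map⁺ (to f)
    (Equivalence.from (EA.exact (from f y)) (from-ok f ok , trans (wt-from f ok) e)))

-- Sorted lists of parts, and splitting them by disjoint predicates.

listing : Rel ℕ 0ℓ → Pred ℕ 0ℓ → Class
listing R φ = record
  { Carrier = List ℕ
  ; Ok      = λ l → AllPairs R l × All φ l
  ; wt      = λ l → + sum l }

partitions distinct : Pred ℕ 0ℓ → Class
partitions = listing _≤_
distinct   = listing _<_

listing-⇔ : ∀ {R} {φ ψ : Pred ℕ 0ℓ} → (∀ {x} → φ x → ψ x) → (∀ {x} → ψ x → φ x) →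
            listing R φ ≃ listing R ψ
listing-⇔ φ⇒ψ ψ⇒φ = record
  { to = id ; from = id
  ; to-ok = λ (s , a) → s , All.map φ⇒ψ a
  ; from-ok = λ (s , a) → s , All.map ψ⇒φ a
  ; from-to = λ _ → refl ; to-from = λ _ → refl ; wt-to = λ _ → refl }

-- Stated at a single number, so that it is decidable and can be verified residue by residue.
record Splits (φ φ₁ φ₂ : Pred ℕ 0ℓ) (x : ℕ) : Set where
  constructor splits
  field
    cover    : φ x → φ₁ x ⊎ φ₂ x
    inl      : φ₁ x → φ x
    inr      : φ₂ x → φ x
    disjoint : ¬ (φ₁ x × φ₂ x)

open Splits

merge : List ℕ → List ℕ → List ℕ
merge []       ys       = ys
merge (x ∷ xs) []       = x ∷ xs
merge (x ∷ xs) (y ∷ ys) with x ≤? y | merge xs (y ∷ ys) | merge (x ∷ xs) ys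
... | yes _ | l | _ = x ∷ l
... | no  _ | _ | l = y ∷ l

merge-All : ∀ {P : Pred ℕ 0ℓ} {xs ys} → All P xs → All P ys → All P (merge xs ys)
merge-All                        []       qs       = qs
merge-All                        (p ∷ ps) []       = p ∷ ps
merge-All {xs = x ∷ xs} {y ∷ ys} (p ∷ ps) (q ∷ qs)
  with x ≤? y | merge-All ps (q ∷ qs) | merge-All (p ∷ ps) qs
... | yes _ | rs | _  = p ∷ rs
... | no  _ | _  | rs = q ∷ rs

merge-∷ˡ : ∀ x xs ys → All (x ≤_) ys → merge (x ∷ xs) ys ≡ x ∷ merge xs ys
merge-∷ˡ x []       []       _         = refl
merge-∷ˡ x (_ ∷ _)  []       _         = refl
merge-∷ˡ x xs       (y ∷ ys) (x≤y ∷ _) with x ≤? y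
... | yes _   = refl
... | no  x≰y = contradiction x≤y x≰y

merge-∷ʳ : ∀ y xs ys → All (y <_) xs → merge xs (y ∷ ys) ≡ y ∷ merge xs ys
merge-∷ʳ y []       ys _         = refl
merge-∷ʳ y (x ∷ xs) ys (y<x ∷ _) with x ≤? y
... | yes x≤y = contradiction x≤y (ℕ.<⇒≱ y<x)
... | no  _   = refl

module _ {R : Rel ℕ 0ℓ} (<⇒R : ∀ {x y} → x < y → R x y) (R⇒≤ : ∀ {x y} → R x y → x ≤ y)
         {φ φ₁ φ₂ : Pred ℕ 0ℓ} (φ₁? : Decidable φ₁) (φ₂? : Decidable φ₂)
         (split : ∀ x → Splits φ φ₁ φ₂ x)
  where
  private
    apart : ∀ {x y} → φ₁ x → φ₂ y → x ≢ y
    apart p q refl = disjoint (split _) (p , q)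

    merge-sorted : ∀ {xs ys} → AllPairs R xs → AllPairs R ys → All φ₁ xs → All φ₂ ys →
                   AllPairs R (merge xs ys)
    merge-sorted                     []       ss       _        _        = ss
    merge-sorted                     (r ∷ rs) []       _        _        = r ∷ rs
    merge-sorted {x ∷ xs} {y ∷ ys} (r ∷ rs) (s ∷ ss) (p ∷ ps) (q ∷ qs)
      with x ≤? y | merge-sorted rs (s ∷ ss) ps (q ∷ qs) | merge-sorted (r ∷ rs) ss (p ∷ ps) qs
    ... | yes x≤y | ts | _ =
      merge-All r (<⇒R x<y ∷ All.map (λ Ryz → <⇒R (ℕ.<-≤-trans x<y (R⇒≤ Ryz))) s)
      ∷ ts
      where x<y = ℕ.≤∧≢⇒< x≤y (apart p q)
    ... | no  x≰y | _ | ts =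
      merge-All (<⇒R y<x ∷ All.map (λ Rxz → <⇒R (ℕ.<-≤-trans y<x (R⇒≤ Rxz))) r) s
      ∷ ts
      where y<x = ℕ.≰⇒> x≰y

    filter₁-merge : ∀ {xs ys} → All φ₁ xs → All φ₂ ys → filter φ₁? (merge xs ys) ≡ xs
    filter₁-merge                    []       qs = filter-none φ₁? (All.map (λ q p → disjoint (split _) (p , q)) qs)
    filter₁-merge                    (p ∷ ps) [] = filter-all φ₁? (p ∷ ps)
    filter₁-merge {x ∷ xs} {y ∷ ys} (p ∷ ps) (q ∷ qs)
      with x ≤? y | filter₁-merge ps (q ∷ qs) | filter₁-merge (p ∷ ps) qs
    ... | yes _ | e | _ = trans (filter-accept φ₁? p) (cong (x ∷_) e)
    ... | no  _ | _ | e = trans (filter-reject φ₁? λ p′ → disjoint (split y) (p′ , q)) e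

    filter₂-merge : ∀ {xs ys} → All φ₁ xs → All φ₂ ys → filter φ₂? (merge xs ys) ≡ ys
    filter₂-merge                    []       qs = filter-all φ₂? qs
    filter₂-merge                    (p ∷ ps) [] = filter-none φ₂? (All.map (λ p q → disjoint (split _) (p , q)) (p ∷ ps))
    filter₂-merge {x ∷ xs} {y ∷ ys} (p ∷ ps) (q ∷ qs)
      with x ≤? y | filter₂-merge ps (q ∷ qs) | filter₂-merge (p ∷ ps) qs
    ... | yes _ | e | _ = trans (filter-reject φ₂? λ q′ → disjoint (split x) (p , q′)) e
    ... | no  _ | _ | e = trans (filter-accept φ₂? q) (cong (y ∷_) e)

    merge-filter : ∀ {l} → AllPairs R l → All φ l → merge (filter φ₁? l) (filter φ₂? l) ≡ l
    merge-filter []                [] = refl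
    merge-filter {x ∷ l} (r ∷ rs) (p ∷ ps) with cover (split x) p
    ... | inj₁ p₁ rewrite filter-accept φ₁? {xs = l} p₁
                        | filter-reject φ₂? {xs = l} (λ p₂ → disjoint (split x) (p₁ , p₂)) =
      trans (merge-∷ˡ x (filter φ₁? l) (filter φ₂? l) (All.filter⁺ φ₂? (All.map R⇒≤ r)))
            (cong (x ∷_) (merge-filter rs ps))
    ... | inj₂ p₂ rewrite filter-accept φ₂? {xs = l} p₂
                        | filter-reject φ₁? {xs = l} (λ p₁ → disjoint (split x) (p₁ , p₂)) =
      trans (merge-∷ʳ x (filter φ₁? l) (filter φ₂? l)
              (All.map (λ (x≤y , q) → ℕ.≤∧≢⇒< x≤y λ x≡y → apart q p₂ (sym x≡y))
                (All.zip (All.filter⁺ φ₁? (All.map R⇒≤ r) , All.all-filter φ₁? l))))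
            (cong (x ∷_) (merge-filter rs ps))

    sum-merge : ∀ xs ys → sum (merge xs ys) ≡ sum xs + sum ys
    sum-merge []       ys       = refl
    sum-merge (x ∷ xs) []       = sym (ℕ.+-identityʳ _)
    sum-merge (x ∷ xs) (y ∷ ys) with x ≤? y | sum-merge xs (y ∷ ys) | sum-merge (x ∷ xs) ys
    ... | yes _ | e | _ = trans (cong (_+_ x) e) (sym (ℕ.+-assoc x (sum xs) (y + sum ys)))
    ... | no  _ | _ | e = trans (cong (_+_ y) e)
      (solve 4 (λ x xs y ys → y :+ ((x :+ xs) :+ ys) := (x :+ xs) :+ (y :+ ys)) refl x (sum xs) y (sum ys))
      where open +-*-Solver

  -- `R` lies between `_<_` and `_≤_`, so one argument serves distinct and unrestricted parts.
  -- Elements of the two sublists are never equal, by disjointness, so the merge has no ties and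
  -- each comparison across the sublists is strict.
  listing-split : listing R φ ≃ listing R φ₁ ⊗ listing R φ₂
  listing-split = record
    { to      = λ l → filter φ₁? l , filter φ₂? l
    ; from    = λ (xs , ys) → merge xs ys
    ; to-ok   = λ {l} (s , _) → (AllPairs.filter⁺ φ₁? s , All.all-filter φ₁? l)
                              , (AllPairs.filter⁺ φ₂? s , All.all-filter φ₂? l)
    ; from-ok = λ ((s , ps) , (t , qs)) →
        merge-sorted s t ps qs
        , merge-All (All.map (λ {x} → inl (split x)) ps) (All.map (λ {x} → inr (split x)) qs)
    ; from-to = λ (s , ps) → merge-filter s ps
    ; to-from = λ ((_ , ps) , (_ , qs)) → cong₂ _,_ (filter₁-merge ps qs) (filter₂-merge ps qs)
    ; wt-to   = λ {l} (s , ps) → trans (sym (ℤ.pos-+ (sum (filter φ₁? l)) (sum (filter φ₂? l))))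
        (cong +_ (trans (sym (sum-merge (filter φ₁? l) (filter φ₂? l))) (cong sum (merge-filter s ps))))
    }

partitions-split : ∀ {φ φ₁ φ₂} → Decidable φ₁ → Decidable φ₂ → (∀ x → Splits φ φ₁ φ₂ x) →
                   partitions φ ≃ partitions φ₁ ⊗ partitions φ₂
partitions-split = listing-split ℕ.<⇒≤ id

distinct-split : ∀ {φ φ₁ φ₂} → Decidable φ₁ → Decidable φ₂ → (∀ x → Splits φ φ₁ φ₂ x) →
                 distinct φ ≃ distinct φ₁ ⊗ distinct φ₂
distinct-split = listing-split id ℕ.<⇒≤

-- Doubling every part.

module _ {φ ψ : Pred ℕ 0ℓ} (φ⇒ψ : ∀ {x} → φ x → ψ (2 * x)) (ψ⇒φ : ∀ {y} → ψ y → ∃[ x ] y ≡ 2 * x × φ x)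
  where
  private
    halve-double : ∀ x → 2 * x / 2 ≡ x
    halve-double x = trans (cong (_/ 2) (ℕ.*-comm 2 x)) (m*n/n≡m x 2)

    double-halve : ∀ {y} → ψ y → 2 * (y / 2) ≡ y
    double-halve q with ψ⇒φ q
    ... | x , refl , _ = cong (_*_ 2) (halve-double x)

    halved : ∀ {y} → ψ y → φ (y / 2)
    halved q with ψ⇒φ q
    ... | x , refl , p = subst φ (sym (halve-double x)) p

    halve-doubles : ∀ l → map (_/ 2) (map (_*_ 2) l) ≡ l
    halve-doubles []      = refl
    halve-doubles (x ∷ l) = cong₂ _∷_ (halve-double x) (halve-doubles l)

    double-halves : ∀ {l} → All ψ l → map (_*_ 2) (map (_/ 2) l) ≡ l
    double-halves []       = refl
    double-halves (q ∷ qs) = cong₂ _∷_ (double-halve q) (double-halves qs)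

    halves-sorted : ∀ {l} → All ψ l → AllPairs _≤_ l → AllPairs _≤_ (map (_/ 2) l)
    halves-sorted []       []       = []
    halves-sorted (q ∷ qs) (r ∷ rs) =
      All.map⁺ (All.map (λ (x≤y , q′) → ℕ.*-cancelˡ-≤ 2 (subst₂ _≤_ (sym (double-halve q)) (sym (double-halve q′)) x≤y))
                        (All.zip (r , qs)))
      ∷ halves-sorted qs rs

    sum-double : ∀ l → sum (map (_*_ 2) l) ≡ 2 * sum l
    sum-double []      = refl
    sum-double (x ∷ l) = trans (cong (_+_ (2 * x)) (sum-double l)) (sym (ℕ.*-distribˡ-+ 2 x (sum l)))

  double-partitions : double (partitions φ) ≃ partitions ψ
  double-partitions = record
    { to      = map (_*_ 2)
    ; from    = map (_/ 2)
    ; to-ok   = λ (s , ps) → AllPairs.map⁺ (AllPairs.map (ℕ.*-monoʳ-≤ 2) s) , All.map⁺ (All.map φ⇒ψ ps)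
    ; from-ok = λ (s , qs) → halves-sorted qs s , All.map⁺ (All.map halved qs)
    ; from-to = λ {l} _ → halve-doubles l
    ; to-from = λ (_ , qs) → double-halves qs
    ; wt-to   = λ {l} _ → trans (cong +_ (sum-double l)) (ℤ.pos-* 2 (sum l)) }

-- Parity of multiplicities.

-- The multiplicity 2f + e of a part, e ∈ {0 , 1}, becomes e in the first list and f in the second.

toggle : ℕ → List ℕ × List ℕ → List ℕ × List ℕ
toggle x ([]    , e) = x ∷ [] , e
toggle x (y ∷ d , e) with x ≟ y
... | yes _ = d , x ∷ e
... | no  _ = x ∷ y ∷ d , e

-- On a sorted list the recursion starts from the largest part, so each new x is at most everything
-- already stored. Looking at the head of the first list therefore decides whether x has its parity
-- bit set; if so, the second copy clears it and carries x into the second list.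
pairOff : List ℕ → List ℕ × List ℕ
pairOff []      = [] , []
pairOff (x ∷ l) = toggle x (pairOff l)

unpair : List ℕ → List ℕ → List ℕ
unpair d       []      = d
unpair []      (y ∷ e) = y ∷ y ∷ unpair [] e
-- On a tie the single copy goes first; in the other branch y is then strictly below all of the
-- first list, as `toggle-twice` demands.
unpair (x ∷ d) (y ∷ e) with x ≤? y | unpair d (y ∷ e) | unpair (x ∷ d) e
... | yes _ | l | _ = x ∷ l
... | no  _ | _ | l = y ∷ y ∷ l

toggle-∷ : ∀ {x d} e → All (x <_) d → toggle x (d , e) ≡ (x ∷ d , e)
toggle-∷           e []         = refl
toggle-∷ {x} {y ∷ _} e (x<y ∷ _) with x ≟ y
... | yes refl = contradiction x<y (ℕ.<-irrefl refl)
... | no  _    = refl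

toggle² : ∀ {x d} e → All (x <_) d → toggle x (x ∷ d , e) ≡ (d , x ∷ e)
toggle² {x} e _ with x ≟ x
... | yes _   = refl
... | no  x≢x = contradiction refl x≢x

-- The bit of x is set by one copy and cleared by the next, which leaves only the carry.
toggle-twice : ∀ {x d} e → All (x <_) d → toggle x (toggle x (d , e)) ≡ (d , x ∷ e)
toggle-twice {x} e x<d = trans (cong (toggle x) (toggle-∷ e x<d)) (toggle² e x<d)

unpair-∷ : ∀ {x} d e → All (x ≤_) e → unpair (x ∷ d) e ≡ x ∷ unpair d e
unpair-∷     d []      _         = refl
unpair-∷ {x} d (y ∷ e) (x≤y ∷ _) with x ≤? y
... | yes _   = refl
... | no  x≰y = contradiction x≤y x≰y

unpair-∷∷ : ∀ {y} d e → All (y <_) d → unpair d (y ∷ e) ≡ y ∷ y ∷ unpair d e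
unpair-∷∷     []      e _         = refl
unpair-∷∷ {y} (x ∷ d) e (y<x ∷ _) with x ≤? y
... | yes x≤y = contradiction x≤y (ℕ.<⇒≱ y<x)
... | no  _   = refl

unpair-All : ∀ {P : Pred ℕ 0ℓ} {d e} → All P d → All P e → All P (unpair d e)
unpair-All                     ps       []       = ps
unpair-All                     []       (q ∷ qs) = q ∷ q ∷ unpair-All [] qs
unpair-All {d = x ∷ d} {y ∷ e} (p ∷ ps) (q ∷ qs)
  with x ≤? y | unpair-All ps (q ∷ qs) | unpair-All (p ∷ ps) qs
... | yes _ | rs | _  = p ∷ rs
... | no  _ | _  | rs = q ∷ q ∷ rs

unpair-sorted : ∀ {d e} → AllPairs _<_ d → AllPairs _≤_ e → AllPairs _≤_ (unpair d e)
unpair-sorted                    rs       []       = AllPairs.map ℕ.<⇒≤ rs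
unpair-sorted                    []       (s ∷ ss) =
  (ℕ.≤-refl ∷ unpair-All [] s) ∷ unpair-All [] s ∷ unpair-sorted [] ss
unpair-sorted {x ∷ d} {y ∷ e} (r ∷ rs) (s ∷ ss)
  with x ≤? y | unpair-sorted rs (s ∷ ss) | unpair-sorted (r ∷ rs) ss
... | yes x≤y | ts | _  =
  unpair-All (All.map ℕ.<⇒≤ r) (x≤y ∷ All.map (ℕ.≤-trans x≤y) s) ∷ ts
... | no  x≰y | _  | ts = (ℕ.≤-refl ∷ y≤) ∷ y≤ ∷ ts
  where
  y<x = ℕ.≰⇒> x≰y
  y≤ = unpair-All (ℕ.<⇒≤ y<x ∷ All.map (ℕ.<⇒≤ ∘ ℕ.<-trans y<x) r) s

toggle-All : ∀ {P : Pred ℕ 0ℓ} {x} d e → P x → All P d → All P e →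
             let (d′ , e′) = toggle x (d , e) in All P d′ × All P e′
toggle-All         []      e p _        qs = p ∷ [] , qs
toggle-All {x = x} (y ∷ d) e p (p′ ∷ ps) qs with x ≟ y
... | yes _ = ps , p ∷ qs
... | no  _ = p ∷ p′ ∷ ps , qs

pairOff-All : ∀ {P : Pred ℕ 0ℓ} {l} → All P l → All P (proj₁ (pairOff l)) × All P (proj₂ (pairOff l))
pairOff-All []             = [] , []
pairOff-All {l = _ ∷ l} (p ∷ ps) = toggle-All _ _ p (proj₁ (pairOff-All ps)) (proj₂ (pairOff-All ps))

Sorted : List ℕ × List ℕ → Set
Sorted (d , e) = AllPairs _<_ d × AllPairs _≤_ e

toggle-sorted : ∀ {x} d e → All (x ≤_) d → All (x ≤_) e → Sorted (d , e) → Sorted (toggle x (d , e))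
toggle-sorted     []      e _         _   (_ , ss)       = [] ∷ [] , ss
toggle-sorted {x} (y ∷ d) e (x≤y ∷ _) x≤e (r ∷ rs , ss) with x ≟ y
... | yes _   = rs , x≤e ∷ ss
... | no  x≢y = (x<y ∷ All.map (ℕ.<-trans x<y) r) ∷ r ∷ rs , ss
  where x<y = ℕ.≤∧≢⇒< x≤y x≢y

pairOff-sorted : ∀ {l} → AllPairs _≤_ l → Sorted (pairOff l)
pairOff-sorted []       = [] , []
pairOff-sorted {_ ∷ l} (r ∷ rs) with pairOff-All r
... | x≤d , x≤e = toggle-sorted _ _ x≤d x≤e (pairOff-sorted rs)

unpair-toggle : ∀ {x} d e → All (x ≤_) d → All (x ≤_) e → Sorted (d , e) →
                uncurry unpair (toggle x (d , e)) ≡ x ∷ unpair d e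
unpair-toggle     []      e _         x≤e _ = unpair-∷ [] e x≤e
unpair-toggle {x} (y ∷ d) e (x≤y ∷ _) x≤e (r ∷ rs , ss) with x ≟ y
... | yes refl = trans (unpair-∷∷ d e r) (cong (x ∷_) (sym (unpair-∷ d e x≤e)))
... | no  _    = unpair-∷ (y ∷ d) e x≤e

unpair-pairOff : ∀ {l} → AllPairs _≤_ l → uncurry unpair (pairOff l) ≡ l
unpair-pairOff []       = refl
unpair-pairOff {x ∷ l} (r ∷ rs) with pairOff-All r
... | x≤d , x≤e = trans (unpair-toggle _ _ x≤d x≤e (pairOff-sorted rs)) (cong (x ∷_) (unpair-pairOff rs))

pairOff-unpair : ∀ {d e} → Sorted (d , e) → pairOff (unpair d e) ≡ (d , e)
pairOff-unpair {[]}    {[]}    _             = refl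
pairOff-unpair {x ∷ d} {[]}    (r ∷ rs , _)  =
  trans (cong (toggle x) (pairOff-unpair (rs , []))) (toggle-∷ [] r)
pairOff-unpair {[]}    {y ∷ e} (_ , s ∷ ss)  =
  trans (cong (toggle y ∘ toggle y) (pairOff-unpair ([] , ss))) (toggle-twice e [])
pairOff-unpair {x ∷ d} {y ∷ e} (r ∷ rs , s ∷ ss)
  with x ≤? y | pairOff-unpair (rs , s ∷ ss) | pairOff-unpair (r ∷ rs , ss)
... | yes _   | IH | _  = trans (cong (toggle x) IH) (toggle-∷ (y ∷ e) r)
... | no  x≰y | _  | IH = trans (cong (toggle y ∘ toggle y) IH)
                      (toggle-twice e (y<x ∷ All.map (ℕ.<-trans y<x) r))
  where y<x = ℕ.≰⇒> x≰y

sum-unpair : ∀ d e → sum (unpair d e) ≡ sum d + 2 * sum e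
sum-unpair d       []      = sym (ℕ.+-identityʳ (sum d))
sum-unpair []      (y ∷ e) = trans (cong (λ z → y + (y + z)) (sum-unpair [] e))
  (solve 2 (λ y e → y :+ (y :+ (con 2 :* e)) := con 2 :* (y :+ e)) refl y (sum e))
  where open +-*-Solver
sum-unpair (x ∷ d) (y ∷ e) with x ≤? y | sum-unpair d (y ∷ e) | sum-unpair (x ∷ d) e
... | yes _ | IH | _  = trans (cong (_+_ x) IH) (sym (ℕ.+-assoc x (sum d) _))
... | no  _ | _  | IH = trans (cong (λ z → y + (y + z)) IH)
  (solve 3 (λ d y e → y :+ (y :+ (d :+ con 2 :* e)) := d :+ con 2 :* (y :+ e)) refl (x + sum d) y (sum e))
  where open +-*-Solver

partitions-pairOff : ∀ {φ} → partitions φ ≃ distinct φ ⊗ double (partitions φ)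
partitions-pairOff = record
  { to      = pairOff
  ; from    = uncurry unpair
  ; to-ok   = λ (s , ps) → let (p , q) = pairOff-sorted s ; (t , u) = pairOff-All ps in (p , t) , (q , u)
  ; from-ok = λ ((p , t) , (q , u)) → unpair-sorted p q , unpair-All t u
  ; from-to = λ (s , _) → unpair-pairOff s
  ; to-from = λ ((p , _) , (q , _)) → pairOff-unpair (p , q)
  ; wt-to   = λ {l} (s , _) → let (d , e) = pairOff l in
      trans (trans (cong (ℤ._+_ (+ sum d)) (sym (ℤ.pos-* 2 (sum e)))) (sym (ℤ.pos-+ (sum d) (2 * sum e))))
            (cong +_ (trans (sym (sum-unpair d e)) (cong sum (unpair-pairOff s)))) }

-- Gap sequences of lists in an arithmetic progression.

Progression : (a c : ℕ) → Pred ℕ 0ℓ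
Progression a c x = ∃[ j ] x ≡ c + a * j

module Gaps (a : ℕ) .{{_ : NonZero a}} where

  -- Any list of naturals is the list of gaps of a unique increasing sequence in Progression a c,
  -- strictly increasing for t = 1 and weakly for t = 0.
  decode : (t c : ℕ) → List ℕ → List ℕ
  decode t c []      = []
  decode t c (g ∷ L) = c + a * g ∷ decode t (c + a * (g + t)) L

  encode : (t c : ℕ) → List ℕ → List ℕ
  encode t c []      = []
  encode t c (x ∷ l) = (x ∸ c) / a ∷ encode t (x + a * t) l

  gaps : (t c : ℕ) → Class
  gaps t c = record { Carrier = List ℕ ; Ok = λ _ → ⊤ ; wt = λ L → + sum (decode t c L) }

  private
    gap : ∀ c g → (c + a * g ∸ c) / a ≡ g
    gap c g = trans (cong (_/ a) (trans (ℕ.m+n∸m≡n c (a * g)) (ℕ.*-comm a g))) (m*n/n≡m g a)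

    advance : ∀ c g t → c + a * (g + t) ≡ c + a * g + a * t
    advance c g t = trans (cong (_+_ c) (ℕ.*-distribˡ-+ a g t)) (sym (ℕ.+-assoc c (a * g) (a * t)))

    encode-decode : ∀ t c L → encode t c (decode t c L) ≡ L
    encode-decode t c []      = refl
    encode-decode t c (g ∷ L) = cong₂ _∷_ (gap c g)
      (trans (cong (λ z → encode t z (decode t (c + a * (g + t)) L)) (sym (advance c g t)))
             (encode-decode t (c + a * (g + t)) L))

    decode-progression : ∀ t c L → All (Progression a c) (decode t c L)
    decode-progression t c []      = []
    decode-progression t c (g ∷ L) =
      (g , refl) ∷ All.map (λ { (j , refl) → g + t + j , sym (advance c (g + t) j) })
                           (decode-progression t (c + a * (g + t)) L)

  module _ {R : Rel ℕ 0ℓ} (t : ℕ)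
           (R⁺ : ∀ x j → R x (x + a * (t + j)))
           (R⁻ : ∀ {c x y} → Progression a c x → Progression a c y → R x y → ∃[ j ] y ≡ x + a * (t + j))
    where
    private
      decode-sorted : ∀ c L → AllPairs R (decode t c L)
      decode-sorted c []      = []
      decode-sorted c (g ∷ L) =
        All.map (λ { (j , refl) → subst (R (c + a * g)) (shift j) (R⁺ (c + a * g) j) })
                (decode-progression t (c + a * (g + t)) L)
        ∷ decode-sorted (c + a * (g + t)) L
        where
        shift : ∀ j → c + a * g + a * (t + j) ≡ c + a * (g + t) + a * j
        shift j = solve 5 (λ c a g t j → c :+ a :* g :+ a :* (t :+ j) := c :+ a :* (g :+ t) :+ a :* j) refl c a g t j
          where open +-*-Solver

      decode-encode : ∀ c {l} → AllPairs R l → All (Progression a c) l → decode t c (encode t c l) ≡ l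
      decode-encode c []       []                 = refl
      decode-encode c (r ∷ rs) ((g , refl) ∷ ps) rewrite gap c g | advance c g t =
        cong (c + a * g ∷_) (decode-encode (c + a * g + a * t) rs
          (All.map (λ { (p , Rxy) → let (j , e) = R⁻ (g , refl) p Rxy in j , trans e (advance _ t j) }) (All.zip (ps , r))))

    -- Inside one progression, `R⁺` and `R⁻` make `R` mean "at least t steps further". What follows
    -- a head x thus lies in the progression starting at x + a * t, and is encoded from there.
    gaps≃listing : ∀ c → gaps t c ≃ listing R (Progression a c)
    gaps≃listing c = record
      { to      = decode t c
      ; from    = encode t c
      ; to-ok   = λ {L} _ → decode-sorted c L , decode-progression t c L
      ; from-ok = _
      ; from-to = λ {L} _ → encode-decode t c L
      ; to-from = λ (s , ps) → decode-encode c s ps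
      ; wt-to   = λ _ → refl }

  gaps≃partitions : ∀ c → gaps 0 c ≃ partitions (Progression a c)
  gaps≃partitions = gaps≃listing 0 (λ x j → ℕ.m≤m+n x (a * j)) R⁻
    where
    R⁻ : ∀ {c x y} → Progression a c x → Progression a c y → x ≤ y → ∃[ j ] y ≡ x + a * j
    R⁻ {c} (j , refl) (k , refl) x≤y
      with j≤k ← ℕ.*-cancelˡ-≤ a (ℕ.+-cancelˡ-≤ c _ _ x≤y) =
      k ∸ j , trans (cong (λ z → c + a * z) (sym (ℕ.m+[n∸m]≡n j≤k))) (advance c j (k ∸ j))

  gaps≃distinct : ∀ c → gaps 1 c ≃ distinct (Progression a c)
  gaps≃distinct = gaps≃listing 1 (λ x j → ℕ.m<m+n x (ℕ.<-≤-trans (>-nonZero⁻¹ a) (ℕ.m≤m*n a (suc j)))) R⁻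
    where
    R⁻ : ∀ {c x y} → Progression a c x → Progression a c y → x < y → ∃[ j ] y ≡ x + a * suc j
    R⁻ {c} (j , refl) (k , refl) x<y
      with j<k ← ℕ.*-cancelˡ-< a _ _ (ℕ.+-cancelˡ-< c _ _ x<y) =
      k ∸ suc j , trans (cong (λ z → c + a * z) (sym (trans (ℕ.+-suc j _) (ℕ.m+[n∸m]≡n j<k)))) (advance c j (suc (k ∸ suc j)))

  raise : List ℕ → List ℕ
  raise []      = []
  raise (g ∷ L) = suc g ∷ L

  -- Only the first gap is measured from c, so enlarging it by one moves every part up by a.
  decode-raise : ∀ t c L → decode t c (raise L) ≡ decode t (c + a) L
  decode-raise t c []      = refl
  decode-raise t c (g ∷ L) = cong₂ (λ x y → x ∷ decode t y L) (shift g) (shift (g + t))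
    where
    shift : ∀ g → c + a * suc g ≡ c + a + a * g
    shift g = trans (cong (_+_ c) (ℕ.*-suc a g)) (sym (ℕ.+-assoc c a (a * g)))

  total : (t c : ℕ) → List ℕ → ℤ
  total t c L = + sum (decode t c L)

  ∣_∣ : List ℕ → ℤ
  ∣ L ∣ = + length L

  total-∷ : ∀ t c g L → total t c (g ∷ L) ≡ + c ℤ.+ + a ℤ.* + g ℤ.+ total t (c + a * (g + t)) L
  total-∷ t c g L = trans (ℤ.pos-+ (c + a * g) _)
    (cong (ℤ._+ total t (c + a * (g + t)) L) (trans (ℤ.pos-+ c (a * g)) (cong (ℤ._+_ (+ c)) (ℤ.pos-* a g))))

  total-shift : ∀ t c k L → total t (c + k) L ≡ total t c L ℤ.+ + k ℤ.* ∣ L ∣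
  total-shift t c k []      = sym (trans (ℤ.+-identityˡ _) (ℤ.*-zeroʳ (+ k)))
  total-shift t c k (g ∷ L) = begin
    total t (c + k) (g ∷ L)
      ≡⟨ total-∷ t (c + k) g L ⟩
    + (c + k) ℤ.+ + a ℤ.* + g ℤ.+ total t (c + k + a * (g + t)) L
      ≡⟨ cong₂ (λ x y → x ℤ.+ + a ℤ.* + g ℤ.+ y) (ℤ.pos-+ c k)
               (trans (cong (λ z → total t z L) (swap c k (a * (g + t)))) (total-shift t (c + a * (g + t)) k L)) ⟩
    + c ℤ.+ + k ℤ.+ + a ℤ.* + g ℤ.+ (total t (c + a * (g + t)) L ℤ.+ + k ℤ.* ∣ L ∣)
      ≡⟨ regroup (+ c) (+ k) (+ a ℤ.* + g) (total t (c + a * (g + t)) L) ∣ L ∣ ⟩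
    + c ℤ.+ + a ℤ.* + g ℤ.+ total t (c + a * (g + t)) L ℤ.+ + k ℤ.* (+ 1 ℤ.+ ∣ L ∣)
      ≡⟨ cong (ℤ._+ + k ℤ.* ∣ g ∷ L ∣) (sym (total-∷ t c g L)) ⟩
    total t c (g ∷ L) ℤ.+ + k ℤ.* ∣ g ∷ L ∣ ∎
    where
    open ≡-Reasoning
    swap : ∀ x y z → x + y + z ≡ x + z + y
    swap x y z = trans (ℕ.+-assoc x y z) (trans (cong (_+_ x) (ℕ.+-comm y z)) (sym (ℕ.+-assoc x z y)))
    regroup : ∀ c k g s l → c ℤ.+ k ℤ.+ g ℤ.+ (s ℤ.+ k ℤ.* l) ≡ c ℤ.+ g ℤ.+ s ℤ.+ k ℤ.* (+ 1 ℤ.+ l)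
    regroup = solve-∀

  total-raise : ∀ t c L → total t c (raise L) ≡ total t c L ℤ.+ + a ℤ.* ∣ L ∣
  total-raise t c L = trans (cong (+_ ∘ sum) (decode-raise t c L)) (total-shift t c a L)

  total-0∷ : ∀ c L → total 1 c (0 ∷ L) ≡ + c ℤ.+ (total 1 c L ℤ.+ + a ℤ.* ∣ L ∣)
  total-0∷ c L = trans (total-∷ 1 c 0 L)
    (cong₂ ℤ._+_ (trans (cong (ℤ._+_ (+ c)) (ℤ.*-zeroʳ (+ a))) (ℤ.+-identityʳ (+ c)))
                 (trans (cong (λ z → total 1 (c + z) L) (ℕ.*-identityʳ a)) (total-shift 1 c a L)))

open Gaps using (gaps)

-- The triple product by moving the origin.

-- Jacobi's triple product, read on the Maya diagram whose particles are S and whose holes are T.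
-- Moving the origin one step changes the charge |S| - |T| by one, and every diagram arises in this
-- way from a unique one without holes and with position 0 unoccupied: a partition.
module TripleProduct (h b b′ : ℕ) .{{_ : NonZero (2 * h)}} (b+b′≡2h : b + b′ ≡ 2 * h) where
  private
    a = 2 * h
    open Gaps a hiding (gaps)

    Diagram = List ℕ × List ℕ

    -- `right` turns site -1 into site 0: a hole there vanishes, a particle there joins S. Since t =
    -- 1, prepending or dropping the gap 0 already moves the rest of that list by one site; the
    -- other list is moved by changing its first gap. `left` is the reverse.
    right left : Diagram → Diagram
    right (S , [])        = 0 ∷ S , []
    right (S , zero ∷ T)  = raise S , T
    right (S , suc g ∷ T) = 0 ∷ S , g ∷ T

    left ([]        , T) = [] , 0 ∷ T
    left (zero ∷ S  , T) = S , raise T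
    left (suc g ∷ S , T) = g ∷ S , 0 ∷ T

    left-right : ∀ x → left (right x) ≡ x
    left-right (S     , [])        = refl
    left-right ([]    , zero ∷ T)  = refl
    left-right (_ ∷ _ , zero ∷ T)  = refl
    left-right (S     , suc g ∷ T) = refl

    right-left : ∀ x → right (left x) ≡ x
    right-left ([]        , T)     = refl
    right-left (zero ∷ S  , [])    = refl
    right-left (zero ∷ S  , _ ∷ _) = refl
    right-left (suc g ∷ S , T)     = refl

    move : ℤ → Diagram → Diagram
    move (+ zero)     x = x
    move (+ suc n)    x = right (move (+ n) x)
    move -[1+ zero ]  x = left x
    move -[1+ suc n ] x = left (move -[1+ n ] x)

    move-suc : ∀ z x → move (ℤ.suc z) x ≡ right (move z x)
    move-suc (+ n)        x = refl
    move-suc -[1+ zero ]  x = sym (right-left x)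
    move-suc -[1+ suc n ] x = sym (right-left _)

    move-pred : ∀ z x → move (ℤ.pred z) x ≡ left (move z x)
    move-pred (+ zero)  x = refl
    move-pred (+ suc n) x = sym (left-right _)
    move-pred -[1+ n ]  x = refl

    -- In the absence of holes, a run of particles at sites 0, 1, ... sinks into the filled sea once
    -- the origin is moved past it. Site 0 is then empty, so the next gap is positive and loses one.
    strip : List ℕ → List ℕ
    strip []          = []
    strip (zero ∷ S)  = strip S
    strip (suc g ∷ S) = g ∷ S

    State = ℤ × List ℕ

    inc dec : State → State
    inc (c , L) = ℤ.suc c , L
    dec (c , L) = ℤ.pred c , L

    dec-inc : ∀ s → dec (inc s) ≡ s
    dec-inc (c , L) = cong (_, L) (ℤ.pred-suc c)

    inc-dec : ∀ s → inc (dec s) ≡ s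
    inc-dec (c , L) = cong (_, L) (ℤ.suc-pred c)

    -- Applies `right` until no hole is left, taking each step back from the charge. Spelling out
    -- the cases of `right` makes the recursion structural in the holes.
    analyse : List ℕ → List ℕ → State
    analyse S []          = ∣ S ∣ , strip S
    analyse S (zero ∷ T)  = dec (analyse (raise S) T)
    analyse S (suc g ∷ T) = dec (analyse (0 ∷ S) (g ∷ T))

    -- The diagram `raise L` without holes has charge `∣ L ∣`, so c - `∣ L ∣` moves bring it to
    -- charge c.
    build : State → Diagram
    build (c , L) = move (c ℤ.- ∣ L ∣) (raise L , [])

    -- `analyse` turns a move of the origin into a change of charge, and `build-inc` and `build-dec`
    -- do the converse. The inverse laws thereby reduce to diagrams without holes.
    analyse-right : ∀ x → uncurry analyse (right x) ≡ inc (uncurry analyse x)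
    analyse-right (S , [])        = refl
    analyse-right (S , zero ∷ T)  = sym (inc-dec _)
    analyse-right (S , suc g ∷ T) = sym (inc-dec _)

    analyse-left : ∀ x → uncurry analyse (left x) ≡ dec (uncurry analyse x)
    analyse-left x = begin
      uncurry analyse (left x)                   ≡⟨ dec-inc _ ⟨
      dec (inc (uncurry analyse (left x)))       ≡⟨ cong dec (analyse-right (left x)) ⟨
      dec (uncurry analyse (right (left x)))     ≡⟨ cong (dec ∘ uncurry analyse) (right-left x) ⟩
      dec (uncurry analyse x)                    ∎
      where open ≡-Reasoning

    add : ℤ → State → State
    add z (c , L) = z ℤ.+ c , L

    analyse-move : ∀ z x → uncurry analyse (move z x) ≡ add z (uncurry analyse x)
    analyse-move (+ zero)     (S , T) = cong (_, proj₂ (analyse S T)) (sym (ℤ.+-identityˡ (proj₁ (analyse S T))))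
    analyse-move (+ suc n)    x@(S , T) = trans (analyse-right (move (+ n) x))
      (trans (cong inc (analyse-move (+ n) x))
             (cong (_, proj₂ (analyse S T)) (sym (ℤ.+-assoc (+ 1) (+ n) (proj₁ (analyse S T))))))
    analyse-move -[1+ zero ]  x = analyse-left x
    analyse-move -[1+ suc n ] x@(S , T) = trans (analyse-left (move -[1+ n ] x))
      (trans (cong dec (analyse-move -[1+ n ] x))
             (cong (_, proj₂ (analyse S T)) (sym (ℤ.+-assoc (ℤ.- (+ 1)) -[1+ n ] (proj₁ (analyse S T))))))

    length-raise : ∀ L → ∣ raise L ∣ ≡ ∣ L ∣
    length-raise []      = refl
    length-raise (_ ∷ _) = refl

    strip-raise : ∀ L → strip (raise L) ≡ L
    strip-raise []      = refl
    strip-raise (_ ∷ _) = refl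

    analyse-build : ∀ s → uncurry analyse (build s) ≡ s
    analyse-build (c , L) = trans (analyse-move (c ℤ.- ∣ L ∣) (raise L , []))
      (cong₂ _,_ (trans (cong (ℤ._+_ (c ℤ.- ∣ L ∣)) (length-raise L)) (cancel c ∣ L ∣)) (strip-raise L))
      where
      cancel : ∀ x y → x ℤ.- y ℤ.+ y ≡ x
      cancel = solve-∀

    build-inc : ∀ s → build (inc s) ≡ right (build s)
    build-inc (c , L) = trans (cong (λ z → move z (raise L , [])) (ℤ.+-assoc (+ 1) c (ℤ.- ∣ L ∣)))
                              (move-suc (c ℤ.- ∣ L ∣) (raise L , []))

    build-dec : ∀ s → build (dec s) ≡ left (build s)
    build-dec (c , L) = trans (cong (λ z → move z (raise L , [])) (ℤ.+-assoc (ℤ.- (+ 1)) c (ℤ.- ∣ L ∣)))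
                              (move-pred (c ℤ.- ∣ L ∣) (raise L , []))

    build-analyse : ∀ S T → build (analyse S T) ≡ (S , T)
    build-analyse []          []          = refl
    build-analyse (zero ∷ S)  []          =
      trans (build-inc (∣ S ∣ , strip S)) (cong right (build-analyse S []))
    build-analyse (suc g ∷ S) []          = cong (λ z → move z (suc g ∷ S , [])) (ℤ.+-inverseʳ ∣ g ∷ S ∣)
    build-analyse S           (zero ∷ T)  =
      trans (build-dec (analyse (raise S) T)) (trans (cong left (build-analyse (raise S) T)) (left-right (S , zero ∷ T)))
    build-analyse S           (suc g ∷ T) =
      trans (build-dec (analyse (0 ∷ S) (g ∷ T))) (cong left (build-analyse (0 ∷ S) (g ∷ T)))

    charge : ∀ S T → proj₁ (analyse S T) ≡ ∣ S ∣ ℤ.- ∣ T ∣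
    charge S []          = sym (ℤ.+-identityʳ ∣ S ∣)
    charge S (zero ∷ T)  = trans (cong ℤ.pred (trans (charge (raise S) T) (cong (ℤ._- ∣ T ∣) (length-raise S))))
                                 (eq ∣ S ∣ ∣ T ∣)
      where
      eq : ∀ s t → ℤ.- (+ 1) ℤ.+ (s ℤ.- t) ≡ s ℤ.- (+ 1 ℤ.+ t)
      eq = solve-∀
    charge S (suc g ∷ T) = trans (cong ℤ.pred (charge (0 ∷ S) (g ∷ T))) (eq ∣ S ∣ ∣ T ∣)
      where
      eq : ∀ s t → ℤ.- (+ 1) ℤ.+ (+ 1 ℤ.+ s ℤ.- (+ 1 ℤ.+ t)) ≡ s ℤ.- (+ 1 ℤ.+ t)
      eq = solve-∀

  -- The weight of the lightest diagram of charge c: the sum of the c numbers b, b + 2h, b + 4h, ...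
  -- if c ≥ 0, and of the -c numbers b′, b′ + 2h, b′ + 4h, ... if c ≤ 0.
  quadratic : ℤ → ℤ
  quadratic c = + h ℤ.* c ℤ.* c ℤ.+ (+ b ℤ.- + h) ℤ.* c

  charges : Class
  charges = record { Carrier = ℤ ; Ok = λ _ → ⊤ ; wt = quadratic }

  private
    weight : State → ℤ
    weight (c , L) = quadratic c ℤ.+ total 0 a L

    +a : + a ≡ + 2 ℤ.* + h
    +a = ℤ.pos-* 2 h

    +b′ : + b′ ≡ + a ℤ.- + b
    +b′ = trans (eq (+ b) (+ b′)) (cong (ℤ._- + b) (trans (sym (ℤ.pos-+ b b′)) (cong +_ b+b′≡2h)))
      where
      eq : ∀ x y → y ≡ x ℤ.+ y ℤ.- x
      eq = solve-∀

    -- Strict spacing adds the staircase 0, a, 2a, ... to the weak sequence. Writing a = 2h makes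
    -- its sum h l (l - 1) for length l, with no division.
    total-strict : ∀ c L → total 1 c L ≡ total 0 c L ℤ.+ + h ℤ.* ∣ L ∣ ℤ.* (∣ L ∣ ℤ.- + 1)
    total-strict c []      = eq (+ h)
      where
      eq : ∀ h → + 0 ≡ + 0 ℤ.+ h ℤ.* + 0 ℤ.* (+ 0 ℤ.- + 1)
      eq = solve-∀
    total-strict c (g ∷ L) = begin
      total 1 c (g ∷ L)
        ≡⟨ total-∷ 1 c g L ⟩
      x ℤ.+ total 1 (c + a * (g + 1)) L
        ≡⟨ cong (λ z → x ℤ.+ total 1 z L) (step g) ⟩
      x ℤ.+ total 1 (c + a * (g + 0) + a) L
        ≡⟨ cong (ℤ._+_ x) (trans (total-shift 1 (c + a * (g + 0)) a L)
                                  (cong₂ (λ z w → z ℤ.+ w ℤ.* ∣ L ∣) (total-strict (c + a * (g + 0)) L) +a)) ⟩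
      x ℤ.+ (total 0 (c + a * (g + 0)) L ℤ.+ + h ℤ.* ∣ L ∣ ℤ.* (∣ L ∣ ℤ.- + 1) ℤ.+ + 2 ℤ.* + h ℤ.* ∣ L ∣)
        ≡⟨ eq x (total 0 (c + a * (g + 0)) L) (+ h) ∣ L ∣ ⟩
      x ℤ.+ total 0 (c + a * (g + 0)) L ℤ.+ + h ℤ.* (+ 1 ℤ.+ ∣ L ∣) ℤ.* (+ 1 ℤ.+ ∣ L ∣ ℤ.- + 1)
        ≡⟨ cong (ℤ._+ + h ℤ.* ∣ g ∷ L ∣ ℤ.* (∣ g ∷ L ∣ ℤ.- + 1)) (sym (total-∷ 0 c g L)) ⟩
      total 0 c (g ∷ L) ℤ.+ + h ℤ.* ∣ g ∷ L ∣ ℤ.* (∣ g ∷ L ∣ ℤ.- + 1) ∎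
      where
      open ≡-Reasoning
      x = + c ℤ.+ + a ℤ.* + g
      step : ∀ g → c + a * (g + 1) ≡ c + a * (g + 0) + a
      step g = solve 3 (λ c a g → c :+ a :* (g :+ con 1) := c :+ a :* (g :+ con 0) :+ a) refl c a g
        where open +-*-Solver
      eq : ∀ x s h l → x ℤ.+ (s ℤ.+ h ℤ.* l ℤ.* (l ℤ.- + 1) ℤ.+ + 2 ℤ.* h ℤ.* l)
                     ≡ x ℤ.+ s ℤ.+ h ℤ.* (+ 1 ℤ.+ l) ℤ.* (+ 1 ℤ.+ l ℤ.- + 1)
      eq = solve-∀

    -- Passing from charge c to c - 1 loses the topmost particle of the lightest diagram, which
    -- weighs b + a (c - 1).
    weight-dec : ∀ s → weight (dec s) ≡ weight s ℤ.- + a ℤ.* ℤ.pred (proj₁ s) ℤ.- + b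
    weight-dec (c , L) =
      trans (eq (+ h) (+ b) c (total 0 a L)) (cong (λ z → weight (c , L) ℤ.- z ℤ.* ℤ.pred c ℤ.- + b) (sym +a))
      where
      eq : ∀ h b c s → h ℤ.* (ℤ.- (+ 1) ℤ.+ c) ℤ.* (ℤ.- (+ 1) ℤ.+ c) ℤ.+ (b ℤ.- h) ℤ.* (ℤ.- (+ 1) ℤ.+ c) ℤ.+ s
                     ≡ h ℤ.* c ℤ.* c ℤ.+ (b ℤ.- h) ℤ.* c ℤ.+ s ℤ.- + 2 ℤ.* h ℤ.* (ℤ.- (+ 1) ℤ.+ c) ℤ.- b
      eq = solve-∀

    -- If site 0 is empty, subtracting b, b + a, b + 2a, ... from the particles leaves positive
    -- multiples of a, and the subtracted numbers sum to `quadratic ∣ L ∣`. Each particle of an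
    -- initial run raises the charge by one and all later particles by a.
    weight-stripped : ∀ S → weight (∣ S ∣ , strip S) ≡ total 1 b S
    weight-stripped []          = eq (+ h) (+ b)
      where
      eq : ∀ h b → h ℤ.* + 0 ℤ.* + 0 ℤ.+ (b ℤ.- h) ℤ.* + 0 ℤ.+ + 0 ≡ + 0
      eq = solve-∀
    weight-stripped (zero ∷ S)  = begin
      weight (∣ 0 ∷ S ∣ , strip S)
        ≡⟨ eq (+ h) (+ b) ∣ S ∣ (total 0 a (strip S)) ⟩
      + b ℤ.+ (weight (∣ S ∣ , strip S) ℤ.+ + 2 ℤ.* + h ℤ.* ∣ S ∣)
        ≡⟨ cong₂ (λ x y → + b ℤ.+ (x ℤ.+ y ℤ.* ∣ S ∣)) (weight-stripped S) (sym +a) ⟩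
      + b ℤ.+ (total 1 b S ℤ.+ + a ℤ.* ∣ S ∣)
        ≡⟨ total-0∷ b S ⟨
      total 1 b (0 ∷ S) ∎
      where
      open ≡-Reasoning
      eq : ∀ h b s l → h ℤ.* (+ 1 ℤ.+ s) ℤ.* (+ 1 ℤ.+ s) ℤ.+ (b ℤ.- h) ℤ.* (+ 1 ℤ.+ s) ℤ.+ l
                     ≡ b ℤ.+ (h ℤ.* s ℤ.* s ℤ.+ (b ℤ.- h) ℤ.* s ℤ.+ l ℤ.+ + 2 ℤ.* h ℤ.* s)
      eq = solve-∀
    weight-stripped (suc g ∷ S) = begin
      quadratic ∣ L ∣ ℤ.+ total 0 a L
        ≡⟨ eq (+ h) (+ b) ∣ L ∣ (total 0 a L) ⟩
      total 0 a L ℤ.+ + b ℤ.* ∣ L ∣ ℤ.+ + h ℤ.* ∣ L ∣ ℤ.* (∣ L ∣ ℤ.- + 1)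
        ≡⟨ cong (ℤ._+ + h ℤ.* ∣ L ∣ ℤ.* (∣ L ∣ ℤ.- + 1))
                (trans (sym (total-shift 0 a b L)) (cong (λ z → total 0 z L) (ℕ.+-comm a b))) ⟩
      total 0 (b + a) L ℤ.+ + h ℤ.* ∣ L ∣ ℤ.* (∣ L ∣ ℤ.- + 1)
        ≡⟨ total-strict (b + a) L ⟨
      total 1 (b + a) L
        ≡⟨ cong (+_ ∘ sum) (decode-raise 1 b L) ⟨
      total 1 b (suc g ∷ S) ∎
      where
      open ≡-Reasoning
      L = g ∷ S
      eq : ∀ h b l s → h ℤ.* l ℤ.* l ℤ.+ (b ℤ.- h) ℤ.* l ℤ.+ s ≡ s ℤ.+ b ℤ.* l ℤ.+ h ℤ.* l ℤ.* (l ℤ.- + 1)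
      eq = solve-∀

    -- Undoing a move lowers every particle by a and raises every remaining hole by a; `charge`
    -- identifies this with the change in `weight-dec`. A new hole at site -1 must weigh a - b,
    -- minus the weight b - a of a particle there, and this is b′ by `b+b′≡2h`.
    weight-analyse : ∀ S T → weight (analyse S T) ≡ total 1 b S ℤ.+ total 1 b′ T
    weight-analyse S []          = trans (weight-stripped S) (sym (ℤ.+-identityʳ _))
    weight-analyse S (zero ∷ T)  = begin
      weight (dec (analyse (raise S) T))
        ≡⟨ weight-dec (analyse (raise S) T) ⟩
      weight (analyse (raise S) T) ℤ.- + a ℤ.* proj₁ (analyse S (zero ∷ T)) ℤ.- + b
        ≡⟨ cong₂ (λ x y → x ℤ.- + a ℤ.* y ℤ.- + b)
             (trans (weight-analyse (raise S) T) (cong (ℤ._+ total 1 b′ T) (total-raise 1 b S)))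
             (charge S (zero ∷ T)) ⟩
      total 1 b S ℤ.+ + a ℤ.* ∣ S ∣ ℤ.+ total 1 b′ T ℤ.- + a ℤ.* (∣ S ∣ ℤ.- (+ 1 ℤ.+ ∣ T ∣)) ℤ.- + b
        ≡⟨ eq (total 1 b S) (total 1 b′ T) (+ a) (+ b) ∣ S ∣ ∣ T ∣ ⟩
      total 1 b S ℤ.+ (+ a ℤ.- + b ℤ.+ (total 1 b′ T ℤ.+ + a ℤ.* ∣ T ∣))
        ≡⟨ cong (λ z → total 1 b S ℤ.+ (z ℤ.+ (total 1 b′ T ℤ.+ + a ℤ.* ∣ T ∣))) (sym +b′) ⟩
      total 1 b S ℤ.+ (+ b′ ℤ.+ (total 1 b′ T ℤ.+ + a ℤ.* ∣ T ∣))
        ≡⟨ cong (ℤ._+_ (total 1 b S)) (sym (total-0∷ b′ T)) ⟩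
      total 1 b S ℤ.+ total 1 b′ (0 ∷ T) ∎
      where
      open ≡-Reasoning
      eq : ∀ x y a b s t → x ℤ.+ a ℤ.* s ℤ.+ y ℤ.- a ℤ.* (s ℤ.- (+ 1 ℤ.+ t)) ℤ.- b
                         ≡ x ℤ.+ (a ℤ.- b ℤ.+ (y ℤ.+ a ℤ.* t))
      eq = solve-∀
    weight-analyse S (suc g ∷ T) = begin
      weight (dec (analyse (0 ∷ S) (g ∷ T)))
        ≡⟨ weight-dec (analyse (0 ∷ S) (g ∷ T)) ⟩
      weight (analyse (0 ∷ S) (g ∷ T)) ℤ.- + a ℤ.* proj₁ (analyse S (suc g ∷ T)) ℤ.- + b
        ≡⟨ cong₂ (λ x y → x ℤ.- + a ℤ.* y ℤ.- + b)
             (trans (weight-analyse (0 ∷ S) (g ∷ T)) (cong (ℤ._+ total 1 b′ (g ∷ T)) (total-0∷ b S)))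
             (charge S (suc g ∷ T)) ⟩
      + b ℤ.+ (total 1 b S ℤ.+ + a ℤ.* ∣ S ∣) ℤ.+ total 1 b′ (g ∷ T) ℤ.- + a ℤ.* (∣ S ∣ ℤ.- ∣ g ∷ T ∣) ℤ.- + b
        ≡⟨ eq (total 1 b S) (total 1 b′ (g ∷ T)) (+ a) (+ b) ∣ S ∣ ∣ g ∷ T ∣ ⟩
      total 1 b S ℤ.+ (total 1 b′ (g ∷ T) ℤ.+ + a ℤ.* ∣ g ∷ T ∣)
        ≡⟨ cong (ℤ._+_ (total 1 b S)) (sym (total-raise 1 b′ (g ∷ T))) ⟩
      total 1 b S ℤ.+ total 1 b′ (suc g ∷ T) ∎
      where
      open ≡-Reasoning
      eq : ∀ x y a b s t → b ℤ.+ (x ℤ.+ a ℤ.* s) ℤ.+ y ℤ.- a ℤ.* (s ℤ.- t) ℤ.- b ≡ x ℤ.+ (y ℤ.+ a ℤ.* t)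
      eq = solve-∀

  tripleProduct : gaps a 1 b ⊗ gaps a 1 b′ ≃ charges ⊗ gaps a 0 a
  tripleProduct = record
    { to      = uncurry analyse
    ; from    = build
    ; to-ok   = _
    ; from-ok = _
    ; from-to = λ {(S , T)} _ → build-analyse S T
    ; to-from = λ {s} _ → analyse-build s
    ; wt-to   = λ {(S , T)} _ → weight-analyse S T }

-- Even-subscripted parts as pairs of odd numbers.

-- A part m_i with i even stands for the two odd numbers nearest to m - i and m + i on the inside
-- (m - i and m + i themselves when m is odd); their sum is 2m.

lo hi : Part → ℕ
lo (m , i) = 1 + 2 * ((m ∸ i) / 2)
hi (m , i) = 2 * m ∸ lo (m , i)

-- Here b - a is 2i for odd m and 2i - 2 for even m. As i is even, the rounded quotient by 4
-- recovers it in both cases.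
part : ℕ → ℕ → Part
part a b = (a + b) / 2 , 2 * suc ((b ∸ a ∸ 2) / 4)

bit : Bool → ℕ
bit false = 0
bit true  = 1

parity : ∀ r → ∃[ e ] ∃[ x ] r ≡ bit e + 2 * x
parity zero    = false , 0 , refl
parity (suc r) with parity r
... | false , x , refl = true , x , refl
... | true  , x , refl = false , suc x , sym (ℕ.*-suc 2 x)

-- The parts with even subscripts, in coordinates in which lo and hi are linear.
mk : ℕ → ℕ → Bool → Part
mk x k e = bit e + 2 * (x + suc k) , 2 * suc k

upper : ℕ → ℕ → Bool → ℕ
upper x k e = x + (1 + 2 * k) + bit e

lo-mk : ∀ x k e → lo (mk x k e) ≡ 1 + 2 * x
lo-mk x k e = cong (λ z → 1 + 2 * z) (begin
  (bit e + 2 * (x + suc k) ∸ 2 * suc k) / 2  ≡⟨ cong (λ z → (z ∸ 2 * suc k) / 2) (regroup (bit e) x k) ⟩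
  (bit e + x * 2 + 2 * suc k ∸ 2 * suc k) / 2 ≡⟨ cong (_/ 2) (ℕ.m+n∸n≡m (bit e + x * 2) (2 * suc k)) ⟩
  (bit e + x * 2) / 2                        ≡⟨ +-distrib-/-∣ʳ (bit e) (n∣m*n x) ⟩
  bit e / 2 + x * 2 / 2                      ≡⟨ cong₂ _+_ (half-bit e) (m*n/n≡m x 2) ⟩
  x                                          ∎)
  where
  open ≡-Reasoning
  regroup : ∀ e x k → e + 2 * (x + suc k) ≡ e + x * 2 + 2 * suc k
  regroup = solve 3 (λ e x k → e :+ con 2 :* (x :+ (con 1 :+ k)) := e :+ x :* con 2 :+ con 2 :* (con 1 :+ k)) refl
    where open +-*-Solver
  half-bit : ∀ e → bit e / 2 ≡ 0
  half-bit false = refl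
  half-bit true  = refl

odds-sum : ∀ x k e → 1 + 2 * upper x k e + (1 + 2 * x) ≡ 2 * value (mk x k e)
odds-sum x k e = solve 3 (λ e x k → con 1 :+ con 2 :* (x :+ (con 1 :+ con 2 :* k) :+ e) :+ (con 1 :+ con 2 :* x)
                                 := con 2 :* (e :+ con 2 :* (x :+ (con 1 :+ k)))) refl (bit e) x k
  where open +-*-Solver

hi-mk : ∀ x k e → hi (mk x k e) ≡ 1 + 2 * upper x k e
hi-mk x k e = trans (cong₂ _∸_ (sym (odds-sum x k e)) (lo-mk x k e)) (ℕ.m+n∸n≡m (1 + 2 * upper x k e) (1 + 2 * x))

part-mk : ∀ x k e → part (1 + 2 * x) (1 + 2 * upper x k e) ≡ mk x k e
part-mk x k e = cong₂ _,_
  (trans (cong (_/ 2) (trans (ℕ.+-comm (1 + 2 * x) (1 + 2 * upper x k e))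
                             (trans (odds-sum x k e) (ℕ.*-comm 2 (value (mk x k e))))))
         (m*n/n≡m (value (mk x k e)) 2))
  (cong (λ z → 2 * suc z) (begin
    (1 + 2 * upper x k e ∸ (1 + 2 * x) ∸ 2) / 4
      ≡⟨ cong (λ z → (z ∸ (1 + 2 * x) ∸ 2) / 4) (regroup (bit e) x k) ⟩
    (1 + 2 * x + (2 + (2 * bit e + k * 4)) ∸ (1 + 2 * x) ∸ 2) / 4
      ≡⟨ cong (λ z → (z ∸ 2) / 4) (ℕ.m+n∸m≡n (1 + 2 * x) (2 + (2 * bit e + k * 4))) ⟩
    (2 * bit e + k * 4) / 4
      ≡⟨ +-distrib-/-∣ʳ (2 * bit e) (n∣m*n k) ⟩
    2 * bit e / 4 + k * 4 / 4
      ≡⟨ cong₂ _+_ (quarter-bit e) (m*n/n≡m k 4) ⟩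
    k ∎))
  where
  open ≡-Reasoning
  regroup : ∀ e x k → 1 + 2 * (x + (1 + 2 * k) + e) ≡ 1 + 2 * x + (2 + (2 * e + k * 4))
  regroup = solve 3 (λ e x k → con 1 :+ con 2 :* (x :+ (con 1 :+ con 2 :* k) :+ e)
                            := con 1 :+ con 2 :* x :+ (con 2 :+ (con 2 :* e :+ k :* con 4))) refl
    where open +-*-Solver
  quarter-bit : ∀ e → 2 * bit e / 4 ≡ 0
  quarter-bit false = refl
  quarter-bit true  = refl

Good : Part → Set
Good p = InM p × Even (subscript p)

good-mk : ∀ x k e → Good (mk x k e)
good-mk x k e = (s≤s z≤n , ℕ.≤-trans (ℕ.*-monoʳ-≤ 2 (ℕ.m≤n+m (suc k) x)) (ℕ.m≤n+m _ (bit e))) , m∣m*n (suc k)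

good⇒mk : ∀ {p} → Good p → ∃[ x ] ∃[ k ] ∃[ e ] p ≡ mk x k e
good⇒mk {m , _} ((() , _) , divides zero refl)
good⇒mk {m , _} ((_ , i≤m) , divides (suc k) refl) with parity (m ∸ suc k * 2)
... | e , x , r≡ = x , k , e , cong₂ _,_
  (trans (sym (ℕ.m∸n+n≡m i≤m)) (trans (cong (_+ suc k * 2) r≡) (regroup (bit e) x k)))
  (ℕ.*-comm (suc k) 2)
  where
  regroup : ∀ e x k → e + 2 * x + suc k * 2 ≡ e + 2 * (x + suc k)
  regroup = solve 3 (λ e x k → e :+ con 2 :* x :+ (con 1 :+ k) :* con 2 := e :+ con 2 :* (x :+ (con 1 :+ k))) refl
    where open +-*-Solver

odds⇒mk : ∀ {a b} → Progression 2 1 a → Progression 2 1 b → a < b →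
          ∃[ x ] ∃[ k ] ∃[ e ] a ≡ 1 + 2 * x × b ≡ 1 + 2 * upper x k e
odds⇒mk (x , refl) (y , refl) (s≤s 2x<2y)
  -- The value (a + b) / 2 = x + y + 1 has the parity of y - (x + 1), which supplies the bit; the
  -- quotient supplies the subscript.
  with x<y ← ℕ.*-cancelˡ-< 2 x y 2x<2y | parity (y ∸ suc x)
... | e , k , d≡ = x , k , e , refl , cong (λ z → 1 + 2 * z) (begin
  y                           ≡⟨ ℕ.m+[n∸m]≡n x<y ⟨
  suc x + (y ∸ suc x)         ≡⟨ cong (_+_ (suc x)) d≡ ⟩
  suc x + (bit e + 2 * k)     ≡⟨ regroup x (bit e) k ⟩
  upper x k e                 ∎)
  where
  open ≡-Reasoning
  regroup : ∀ x e k → suc x + (e + 2 * k) ≡ x + (1 + 2 * k) + e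
  regroup = solve 3 (λ x e k → con 1 :+ x :+ (e :+ con 2 :* k) := x :+ (con 1 :+ con 2 :* k) :+ e) refl
    where open +-*-Solver

Follows : Part → Part → Set
Follows p q = p ≼ q × (0ℤ ℤ.≤ ⟪ q - p ⟫ × ¬ (Odd (value p) × Odd (value q) × ⟪ q - p ⟫ ≡ 0ℤ))

even-value : ∀ x k → ¬ Odd (value (mk x k false))
even-value x k odd = odd (m∣m*n (x + suc k))

odd-value : ∀ x k → Odd (value (mk x k true))
odd-value x k (divides j eq) = ℕ.even≢odd j (x + suc k) (trans (ℕ.*-comm 2 j) (sym eq))

-- For m_i = `mk x k e`, m + i is `bit e + 2 * end x k`, while m - i is `bit e + 2 * x`.
end : ℕ → ℕ → ℕ
end x k = x + (suc k + suc k)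

difference : ∀ x k e x′ k′ e′ →
             ⟪ mk x′ k′ e′ - mk x k e ⟫ ≡ + (bit e′ + 2 * x′) ℤ.- + (bit e + 2 * end x k)
difference x k e x′ k′ e′ = trans
  (cong₂ (λ u v → u ℤ.- v ℤ.- + (2 * suc k′) ℤ.- + (2 * suc k)) (cast (bit e′) x′ (suc k′)) (cast (bit e) x (suc k)))
  (trans (cong₂ (λ u v → + bit e′ ℤ.+ + 2 ℤ.* (+ x′ ℤ.+ + suc k′) ℤ.- (+ bit e ℤ.+ + 2 ℤ.* (+ x ℤ.+ + suc k)) ℤ.- u ℤ.- v)
                (ℤ.pos-* 2 (suc k′)) (ℤ.pos-* 2 (suc k)))
  (trans (regroup (+ bit e) (+ x) (+ suc k) (+ bit e′) (+ x′) (+ suc k′))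
         (cong₂ ℤ._-_ (sym (trans (ℤ.pos-+ (bit e′) (2 * x′)) (cong (ℤ._+_ (+ bit e′)) (ℤ.pos-* 2 x′))))
                      (sym (trans (cast (bit e) x (suc k + suc k))
                                  (cong (λ z → + bit e ℤ.+ + 2 ℤ.* (+ x ℤ.+ z)) (ℤ.pos-+ (suc k) (suc k))))))))
  where
  cast : ∀ e x k → + (e + 2 * (x + k)) ≡ + e ℤ.+ + 2 ℤ.* (+ x ℤ.+ + k)
  cast e x k = trans (ℤ.pos-+ e (2 * (x + k)))
    (cong (ℤ._+_ (+ e)) (trans (ℤ.pos-* 2 (x + k)) (cong (ℤ._*_ (+ 2)) (ℤ.pos-+ x k))))
  regroup : ∀ e x k e′ x′ k′ → e′ ℤ.+ + 2 ℤ.* (x′ ℤ.+ k′) ℤ.- (e ℤ.+ + 2 ℤ.* (x ℤ.+ k)) ℤ.- + 2 ℤ.* k′ ℤ.- + 2 ℤ.* k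
          ≡ e′ ℤ.+ + 2 ℤ.* x′ ℤ.- (e ℤ.+ + 2 ℤ.* (x ℤ.+ (k ℤ.+ k)))
  regroup = solve-∀

-- Compares m + i with m′ - i′ after rounding both to odd numbers. If m is even, rounding m + i down
-- makes the weak inequality enough. If m is odd and m′ even, parity makes the inequality strict. If
-- both are odd, equality is the one bad case, and condition (iii) forbids exactly it.
separated : ∀ e y e′ x′ → bit e + 2 * y ≤ bit e′ + 2 * x′ →
            ¬ (e ≡ true × e′ ≡ true × bit e′ + 2 * x′ ≡ bit e + 2 * y) → y + bit e ≤ x′
separated false y false x′ le _    = subst (_≤ x′) (sym (ℕ.+-identityʳ y)) (ℕ.*-cancelˡ-≤ 2 le)
separated false y true  x′ le _    = subst (_≤ x′) (sym (ℕ.+-identityʳ y))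
  (ℕ.≤-pred (ℕ.*-cancelˡ-< 2 y (suc x′) (subst (2 * y <_) (sym (ℕ.*-suc 2 x′)) (s≤s le))))
separated true  y false x′ le _    = subst (_≤ x′) (ℕ.+-comm 1 y) (ℕ.*-cancelˡ-< 2 y x′ le)
separated true  y true  x′ (s≤s le) ne = subst (_≤ x′) (ℕ.+-comm 1 y)
  (ℕ.≤∧≢⇒< (ℕ.*-cancelˡ-≤ 2 le) λ { refl → ne (refl , refl , refl) })

separated⁻¹ : ∀ e y e′ x′ → y + bit e ≤ x′ → bit e + 2 * y ≤ bit e′ + 2 * x′
separated⁻¹ e y e′ x′ le = begin
  bit e + 2 * y     ≤⟨ bit≤ e ⟩
  2 * (y + bit e)   ≤⟨ ℕ.*-monoʳ-≤ 2 le ⟩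
  2 * x′            ≤⟨ ℕ.m≤n+m (2 * x′) (bit e′) ⟩
  bit e′ + 2 * x′   ∎
  where
  open ℕ.≤-Reasoning
  bit≤ : ∀ e → bit e + 2 * y ≤ 2 * (y + bit e)
  bit≤ false = ℕ.≤-reflexive (cong (2 *_) (sym (ℕ.+-identityʳ y)))
  bit≤ true  = subst (1 + 2 * y ≤_) (trans (sym (ℕ.*-suc 2 y)) (cong (2 *_) (ℕ.+-comm 1 y))) (ℕ.n≤1+n _)

end-upper : ∀ x k e → suc (upper x k e) ≡ end x k + bit e
end-upper x k e = solve 3 (λ x k e → con 1 :+ (x :+ (con 1 :+ con 2 :* k) :+ e)
                                  := x :+ ((con 1 :+ k) :+ (con 1 :+ k)) :+ e) refl x k (bit e)
  where open +-*-Solver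

follows⇒< : ∀ {p q} → Good p → Good q → Follows p q → hi p < lo q
follows⇒< gp gq (_ , 0≤ , ok) with good⇒mk gp | good⇒mk gq
... | x , k , e , refl | x′ , k′ , e′ , refl
  rewrite hi-mk x k e | lo-mk x′ k′ e′ | difference x k e x′ k′ e′ =
  s≤s (ℕ.*-monoʳ-< 2 (subst (_≤ x′) (sym (end-upper x k e))
    (separated e (end x k) e′ x′ (ℤ.drop‿+≤+ (ℤ.0≤i-j⇒j≤i 0≤))
      λ { (refl , refl , eq) → ok (odd-value x k , odd-value x′ k′ , ℤ.i≡j⇒i-j≡0 (cong +_ eq)) })))

<⇒follows : ∀ {p q} → Good p → Good q → hi p < lo q → Follows p q
<⇒follows gp gq lt with good⇒mk gp | good⇒mk gq
... | x , k , e , refl | x′ , k′ , e′ , refl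
  rewrite hi-mk x k e | lo-mk x′ k′ e′ | difference x k e x′ k′ e′ =
  inj₁ value< , ℤ.i≤j⇒0≤j-i (ℤ.+≤+ le) , noOddZero e e′ y≤x′
  where
  y≤x′ : end x k + bit e ≤ x′
  y≤x′ = subst (_≤ x′) (end-upper x k e) (ℕ.*-cancelˡ-< 2 (upper x k e) x′ (ℕ.≤-pred lt))

  le : bit e + 2 * end x k ≤ bit e′ + 2 * x′
  le = separated⁻¹ e (end x k) e′ x′ y≤x′

  -- The chain is m ≤ m + i ≤ m′ - i′ < m′.
  value< : value (mk x k e) < value (mk x′ k′ e′)
  value< = begin-strict
    bit e + 2 * (x + suc k)      ≤⟨ ℕ.+-monoʳ-≤ (bit e) (ℕ.*-monoʳ-≤ 2 (ℕ.+-monoʳ-≤ x (ℕ.m≤m+n (suc k) (suc k)))) ⟩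
    bit e + 2 * end x k          ≤⟨ le ⟩
    bit e′ + 2 * x′              <⟨ ℕ.+-monoʳ-< (bit e′) (ℕ.*-monoʳ-< 2 (ℕ.m<m+n x′ (s≤s z≤n))) ⟩
    bit e′ + 2 * (x′ + suc k′)   ∎
    where open ℕ.≤-Reasoning

  noOddZero : ∀ e e′ → end x k + bit e ≤ x′ →
    ¬ (Odd (value (mk x k e)) × Odd (value (mk x′ k′ e′)) × + (bit e′ + 2 * x′) ℤ.- + (bit e + 2 * end x k) ≡ 0ℤ)
  noOddZero false _     _  (odd , _ , _) = even-value x k odd
  noOddZero true  false _  (_ , odd , _) = even-value x′ k′ odd
  noOddZero true  true  le (_ , _ , eq)  = ℕ.<-irrefl
    (sym (ℕ.*-cancelˡ-≡ x′ (end x k) 2 (ℕ.suc-injective (ℤ.+-injective (ℤ.i-j≡0⇒i≡j _ _ eq)))))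
    (subst (_≤ x′) (ℕ.+-comm (end x k) 1) le)

lo<hi : ∀ {p} → Good p → lo p < hi p
lo<hi gp with good⇒mk gp
... | x , k , e , refl rewrite hi-mk x k e | lo-mk x k e =
  s≤s (ℕ.*-monoʳ-< 2 (ℕ.<-≤-trans (ℕ.m<m+n x (s≤s z≤n)) (ℕ.m≤m+n (x + (1 + 2 * k)) (bit e))))

lo-odd : ∀ p → Progression 2 1 (lo p)
lo-odd (m , i) = (m ∸ i) / 2 , refl

hi-odd : ∀ {p} → Good p → Progression 2 1 (hi p)
hi-odd gp with good⇒mk gp
... | x , k , e , refl = upper x k e , hi-mk x k e

part-lo-hi : ∀ {p} → Good p → part (lo p) (hi p) ≡ p
part-lo-hi gp with good⇒mk gp
... | x , k , e , refl = trans (cong₂ part (lo-mk x k e) (hi-mk x k e)) (part-mk x k e)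

lo+hi : ∀ {p} → Good p → lo p + hi p ≡ 2 * value p
lo+hi gp with good⇒mk gp
... | x , k , e , refl = trans (cong₂ _+_ (lo-mk x k e) (hi-mk x k e))
  (trans (ℕ.+-comm (1 + 2 * x) (1 + 2 * upper x k e)) (odds-sum x k e))

module _ {a b} (oa : Progression 2 1 a) (ob : Progression 2 1 b) (a<b : a < b) where

  good-part : Good (part a b)
  good-part with odds⇒mk oa ob a<b
  ... | x , k , e , refl , refl = subst Good (sym (part-mk x k e)) (good-mk x k e)

  lo-part : lo (part a b) ≡ a
  lo-part with odds⇒mk oa ob a<b
  ... | x , k , e , refl , refl = trans (cong lo (part-mk x k e)) (lo-mk x k e)

  hi-part : hi (part a b) ≡ b
  hi-part with odds⇒mk oa ob a<b
  ... | x , k , e , refl , refl = trans (cong hi (part-mk x k e)) (hi-mk x k e)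

-- Partitions with copies as lists of distinct odd numbers.

expand : List Part → List ℕ
expand []      = []
expand (p ∷ π) = lo p ∷ hi p ∷ expand π

collect : List ℕ → List Part
collect (a ∷ b ∷ l) = part a b ∷ collect l
-- A leftover single part is dropped; `expand-collect` excludes this case by the even sum.
collect _           = []

expand-linked : ∀ {π} → All Good π → Linked Follows π → Linked _<_ (expand π)
expand-linked []                  []       = []
expand-linked (g ∷ [])            [-]      = lo<hi g ∷ [-]
expand-linked (g ∷ g′ ∷ gs)       (f ∷ fs) = lo<hi g ∷ follows⇒< g g′ f ∷ expand-linked (g′ ∷ gs) fs

expand-odd : ∀ {π} → All Good π → All (Progression 2 1) (expand π)
expand-odd []       = []
expand-odd {p ∷ _} (g ∷ gs) = lo-odd p ∷ hi-odd g ∷ expand-odd gs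

sum-expand : ∀ {π} → All Good π → sum (expand π) ≡ 2 * sum (map value π)
sum-expand         []       = refl
sum-expand {p ∷ π} (g ∷ gs) = begin
  lo p + (hi p + sum (expand π))    ≡⟨ ℕ.+-assoc (lo p) (hi p) _ ⟨
  lo p + hi p + sum (expand π)      ≡⟨ cong₂ _+_ (lo+hi g) (sum-expand gs) ⟩
  2 * value p + 2 * sum (map value π) ≡⟨ ℕ.*-distribˡ-+ 2 (value p) _ ⟨
  2 * (value p + sum (map value π)) ∎
  where open ≡-Reasoning

collect-expand : ∀ {π} → All Good π → collect (expand π) ≡ π
collect-expand []       = refl
collect-expand (g ∷ gs) = cong₂ _∷_ (part-lo-hi g) (collect-expand gs)

sum-tail-even : ∀ i j s k → 1 + 2 * i + (1 + 2 * j + s) ≡ 2 * k → ∃[ k′ ] s ≡ 2 * k′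
sum-tail-even i j s k eq = k ∸ (i + j + 1) , (begin
  s                                       ≡⟨ ℕ.m+n∸m≡n (2 * (i + j + 1)) s ⟨
  2 * (i + j + 1) + s ∸ 2 * (i + j + 1)   ≡⟨ cong (_∸ 2 * (i + j + 1)) (trans (regroup i j s) eq) ⟩
  2 * k ∸ 2 * (i + j + 1)                 ≡⟨ ℕ.*-distribˡ-∸ 2 k (i + j + 1) ⟨
  2 * (k ∸ (i + j + 1))                   ∎)
  where
  open ≡-Reasoning
  regroup : ∀ i j s → 2 * (i + j + 1) + s ≡ 1 + 2 * i + (1 + 2 * j + s)
  regroup = solve 3 (λ i j s → con 2 :* (i :+ j :+ con 1) :+ s := con 1 :+ con 2 :* i :+ (con 1 :+ con 2 :* j :+ s)) refl
    where open +-*-Solver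

collect-good : ∀ {l} → Linked _<_ l → All (Progression 2 1) l → All Good (collect l)
collect-good []                []             = []
collect-good [-]               (_ ∷ [])       = []
collect-good (r ∷ [-])         (o ∷ o′ ∷ [])  = good-part o o′ r ∷ []
collect-good (r ∷ (_ ∷ rs))    (o ∷ o′ ∷ os)  = good-part o o′ r ∷ collect-good rs os

collect-linked : ∀ {l} → Linked _<_ l → All (Progression 2 1) l → Linked Follows (collect l)
collect-linked []                       []                  = []
collect-linked [-]                      (_ ∷ [])            = []
collect-linked (_ ∷ [-])                (_ ∷ _ ∷ [])        = [-]
collect-linked (_ ∷ (_ ∷ [-]))          (_ ∷ _ ∷ _ ∷ [])    = [-]
collect-linked (r ∷ (s ∷ (t ∷ rs)))     (o₁ ∷ o₂ ∷ o₃ ∷ o₄ ∷ os) =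
  <⇒follows (good-part o₁ o₂ r) (good-part o₃ o₄ t)
            (subst₂ _<_ (sym (hi-part o₁ o₂ r)) (sym (lo-part o₃ o₄ t)) s)
  ∷ collect-linked (t ∷ rs) (o₃ ∷ o₄ ∷ os)

expand-collect : ∀ {l} k → sum l ≡ 2 * k → Linked _<_ l → All (Progression 2 1) l → expand (collect l) ≡ l
expand-collect         _ _  []       []                       = refl
expand-collect         k eq [-]      ((i , refl) ∷ [])        =
  contradiction (trans (sym eq) (ℕ.+-identityʳ (1 + 2 * i))) (ℕ.even≢odd k i)
expand-collect {_ ∷ _ ∷ l} k eq (r ∷ rs) (o@(i , refl) ∷ o′@(j , refl) ∷ os) =
  let (k′ , eq′) = sum-tail-even i j (sum l) k eq in
  cong₂ _∷_ (lo-part o o′ r) (cong₂ _∷_ (hi-part o o′ r) (expand-collect k′ eq′ (Linked.tail rs) os))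

copyPartitions : Class
copyPartitions = record
  { Carrier = List Part
  ; Ok      = λ π → All Good π × Linked Follows π
  ; wt      = λ π → + sum (map value π) }

copyPartitions≃odds : double copyPartitions ≃ evenPart (distinct (Progression 2 1))
copyPartitions≃odds = record
  { to      = expand
  ; from    = collect
  ; to-ok   = λ {π} (gs , fs) →
      (Linked⇒AllPairs ℕ.<-trans (expand-linked gs fs) , expand-odd gs) , + sum (map value π) , weight gs
  ; from-ok = λ ((s , os) , _) → collect-good (AllPairs⇒Linked s) os , collect-linked (AllPairs⇒Linked s) os
  ; from-to = λ (gs , _) → collect-expand gs
  ; to-from = λ {l} ((s , os) , k , eq) →
      -- The half-sum k is only known as an integer; absolute values give the equation between
      -- naturals.
      expand-collect ℤ.∣ k ∣ (trans (cong ℤ.∣_∣ eq) (ℤ.abs-* (+ 2) k)) (AllPairs⇒Linked s) os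
  ; wt-to   = λ (gs , _) → weight gs }
  where
  weight : ∀ {π} → All Good π → + sum (expand π) ≡ + 2 ℤ.* + sum (map value π)
  weight {π} gs = trans (cong +_ (sum-expand gs)) (ℤ.pos-* 2 (sum (map value π)))

-- Residue classes and the splittings they give.

Residue : (m : ℕ) .{{_ : NonZero m}} → List ℕ → Pred ℕ 0ℓ
Residue m rs x = x % m ∈ rs

residue? : ∀ m .{{_ : NonZero m}} rs → Decidable (Residue m rs)
residue? m rs x = x % m ∈? rs

splits? : ∀ {φ φ₁ φ₂} → Decidable φ → Decidable φ₁ → Decidable φ₂ → Decidable (Splits φ φ₁ φ₂)
splits? φ? φ₁? φ₂? x = map′ (λ (c , l , r , d) → splits c l r d) (λ (splits c l r d) → c , l , r , d)
  ((φ? x →-dec (φ₁? x ⊎-dec φ₂? x)) ×-dec (φ₁? x →-dec φ? x) ×-dec (φ₂? x →-dec φ? x)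
   ×-dec ¬? (φ₁? x ×-dec φ₂? x))

-- The moduli 2, 4, 8 and 16 all divide 16, and `(16 + x) % m` computes to `x % m` for each of them.
-- Statements about residues thus pass the step unchanged, and sixteen cases are left to a decision
-- procedure.
mod16-induction : ∀ {P : Pred ℕ 0ℓ} → (∀ x → P x → P (16 + x)) → All P (upTo 16) → ∀ x → P x
mod16-induction {P} step base = <-rec P go
  where
  go : ∀ x → (∀ {y} → y < x → P y) → P x
  go x rec with x <? 16
  ... | yes x<16 = All.lookup base (∈-upTo⁺ x<16)
  ... | no  x≮16 with 16≤x ← ℕ.≮⇒≥ x≮16 = subst P (ℕ.m+[n∸m]≡n 16≤x)
    (step (x ∸ 16) (rec (ℕ.∸-monoʳ-< (s≤s z≤n) 16≤x)))

module _ (a r : ℕ) .{{_ : NonZero a}} where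

  residue⇒progression : ∀ {x} → Residue a (r ∷ []) x → Progression a r x
  residue⇒progression {x} (here refl) = x / a , trans (m≡m%n+[m/n]*n x a) (cong (_+_ (x % a)) (ℕ.*-comm (x / a) a))

  progression⇒residue : r < a → ∀ {x} → Progression a r x → Residue a (r ∷ []) x
  progression⇒residue r<a (j , refl) = here (begin
    (r + a * j) % a  ≡⟨ cong (λ z → (r + z) % a) (ℕ.*-comm a j) ⟩
    (r + j * a) % a  ≡⟨ [m+kn]%n≡m%n r j a ⟩
    r % a            ≡⟨ m<n⇒m%n≡m r<a ⟩
    r                ∎)
    where open ≡-Reasoning

-- Residue 0 admits the number 0, which is no part, so positivity is demanded separately.
Multiple⁺ : (a : ℕ) .{{_ : NonZero a}} → Pred ℕ 0ℓ
Multiple⁺ a x = Residue a (0 ∷ []) x × 0 < x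

module _ (a : ℕ) .{{_ : NonZero a}} where

  multiple⇒progression : ∀ {x} → Multiple⁺ a x → Progression a a x
  multiple⇒progression (p , 0<x) with residue⇒progression a 0 p
  ... | zero  , refl = contradiction (ℕ.≤-trans 0<x (ℕ.≤-reflexive (ℕ.*-zeroʳ a))) λ ()
  ... | suc j , refl = j , ℕ.*-suc a j

  progression⇒multiple : ∀ {x} → Progression a a x → Multiple⁺ a x
  progression⇒multiple (j , refl) =
    progression⇒residue a 0 (>-nonZero⁻¹ a) (suc j , sym (ℕ.*-suc a j)) ,
    ℕ.≤-trans (>-nonZero⁻¹ a) (ℕ.m≤m+n a (a * j))

distinct≃gaps : ∀ a r .{{_ : NonZero a}} → r < a → distinct (Residue a (r ∷ [])) ≃ gaps a 1 r
distinct≃gaps a r r<a = ≃-trans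
  (listing-⇔ (residue⇒progression a r) (progression⇒residue a r r<a)) (≃-sym (Gaps.gaps≃distinct a r))

partitions≃gaps : ∀ a .{{_ : NonZero a}} → partitions (Multiple⁺ a) ≃ gaps a 0 a
partitions≃gaps a = ≃-trans
  (listing-⇔ (multiple⇒progression a) (progression⇒multiple a)) (≃-sym (Gaps.gaps≃partitions a a))

gResidues : List ℕ
gResidues = 2 ∷ 3 ∷ 4 ∷ 5 ∷ 11 ∷ 12 ∷ 13 ∷ 14 ∷ []

GResidue : Pred ℕ 0ℓ
GResidue = Residue 16 gResidues

by-residues : ∀ m m₁ m₂ rs rs₁ rs₂ .{{_ : NonZero m}} .{{_ : NonZero m₁}} .{{_ : NonZero m₂}} →
  Decidable (Splits (Residue m rs) (Residue m₁ rs₁) (Residue m₂ rs₂))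
by-residues m m₁ m₂ rs rs₁ rs₂ = splits? (residue? m rs) (residue? m₁ rs₁) (residue? m₂ rs₂)

-- The residues 3, 5, 11, 13 modulo 16 are together 3, 5 modulo 8, where the triple product can act.
G-split : partitions GResidue ≃ partitions (Residue 8 (3 ∷ 5 ∷ [])) ⊗ partitions (Residue 16 (2 ∷ 4 ∷ 12 ∷ 14 ∷ []))
G-split = partitions-split (residue? _ _) (residue? _ _)
  (mod16-induction (λ _ (splits c l r d) → splits c l r d)
    (from-yes (all? (by-residues 16 8 16 gResidues (3 ∷ 5 ∷ []) (2 ∷ 4 ∷ 12 ∷ 14 ∷ [])) (upTo 16))))

Q-split : partitions (Residue 8 (2 ∷ 4 ∷ 6 ∷ [])) ≃
          partitions (Residue 16 (6 ∷ 10 ∷ [])) ⊗ partitions (Residue 16 (2 ∷ 4 ∷ 12 ∷ 14 ∷ []))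
Q-split = partitions-split (residue? _ _) (residue? _ _)
  (mod16-induction (λ _ (splits c l r d) → splits c l r d)
    (from-yes (all? (by-residues 8 16 16 (2 ∷ 4 ∷ 6 ∷ []) (6 ∷ 10 ∷ []) (2 ∷ 4 ∷ 12 ∷ 14 ∷ [])) (upTo 16))))

±3-split : distinct (Residue 8 (3 ∷ 5 ∷ [])) ≃ distinct (Residue 8 (3 ∷ [])) ⊗ distinct (Residue 8 (5 ∷ []))
±3-split = distinct-split (residue? _ _) (residue? _ _)
  (mod16-induction (λ _ (splits c l r d) → splits c l r d)
    (from-yes (all? (by-residues 8 8 8 (3 ∷ 5 ∷ []) (3 ∷ []) (5 ∷ [])) (upTo 16))))

odd-split : distinct (Residue 2 (1 ∷ [])) ≃ distinct (Residue 4 (1 ∷ [])) ⊗ distinct (Residue 4 (3 ∷ []))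
odd-split = distinct-split (residue? _ _) (residue? _ _)
  (mod16-induction (λ _ (splits c l r d) → splits c l r d)
    (from-yes (all? (by-residues 2 4 4 (1 ∷ []) (1 ∷ []) (3 ∷ [])) (upTo 16))))

even-split : partitions (Multiple⁺ 2) ≃ partitions (Multiple⁺ 8) ⊗ partitions (Residue 8 (2 ∷ 4 ∷ 6 ∷ []))
even-split = partitions-split (λ x → residue? 8 (0 ∷ []) x ×-dec 0 <? x) (residue? _ _) λ x → positive x (unrestricted x)
  where
  unrestricted : ∀ x → Splits (Residue 2 (0 ∷ [])) (Residue 8 (0 ∷ [])) (Residue 8 (2 ∷ 4 ∷ 6 ∷ [])) x
  unrestricted = mod16-induction (λ _ (splits c l r d) → splits c l r d)
    (from-yes (all? (by-residues 2 8 8 (0 ∷ []) (0 ∷ []) (2 ∷ 4 ∷ 6 ∷ [])) (upTo 16)))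

  positive : ∀ x → Splits (Residue 2 (0 ∷ [])) (Residue 8 (0 ∷ [])) (Residue 8 (2 ∷ 4 ∷ 6 ∷ [])) x →
             Splits (Multiple⁺ 2) (Multiple⁺ 8) (Residue 8 (2 ∷ 4 ∷ 6 ∷ [])) x
  positive x (splits c l r d) = splits
    (λ (p , 0<x) → Sum.map₁ (_, 0<x) (c p))
    (λ (p , 0<x) → l p , 0<x)
    (λ p → r p , nonzero x p)
    (λ ((p , _) , q) → d (p , q))
    where
    nonzero : ∀ x → Residue 8 (2 ∷ 4 ∷ 6 ∷ []) x → 0 < x
    nonzero zero    (there (there (there ())))
    nonzero (suc x) _ = s≤s z≤n

±3-double : double (partitions (Residue 8 (3 ∷ 5 ∷ []))) ≃ partitions (Residue 16 (6 ∷ 10 ∷ []))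
±3-double = double-partitions (λ {x} → doubled {x}) halved
  where
  scale : ∀ x → 2 * x % 16 ≡ x % 8 * 2
  scale x = trans (cong (_% 16) (ℕ.*-comm 2 x)) (sym (m%n*o≡m*o%[n*o] x 8 2))

  doubled : ∀ {x} → Residue 8 (3 ∷ 5 ∷ []) x → Residue 16 (6 ∷ 10 ∷ []) (2 * x)
  doubled {x} p = subst (_∈ 6 ∷ 10 ∷ []) (sym (scale x)) (∈-map⁺ (_* 2) p)

  even : ∀ x → Residue 16 (6 ∷ 10 ∷ []) x → Residue 2 (0 ∷ []) x
  even = mod16-induction (λ _ f → f)
    (from-yes (all? (λ x → residue? 16 (6 ∷ 10 ∷ []) x →-dec residue? 2 (0 ∷ []) x) (upTo 16)))

  halved-residue : ∀ {x} → Residue 16 (6 ∷ 10 ∷ []) (2 * x) → Residue 8 (3 ∷ 5 ∷ []) x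
  halved-residue {x} p with ∈-map⁻ (_* 2) {xs = 3 ∷ 5 ∷ []} (subst (_∈ 6 ∷ 10 ∷ []) (scale x) p)
  ... | r , r∈ , eq = subst (_∈ 3 ∷ 5 ∷ []) (sym (ℕ.*-cancelʳ-≡ (x % 8) r 2 eq)) r∈

  halved : ∀ {y} → Residue 16 (6 ∷ 10 ∷ []) y → ∃[ x ] y ≡ 2 * x × Residue 8 (3 ∷ 5 ∷ []) x
  halved {y} q with residue⇒progression 2 0 {y} (even y q)
  ... | x , refl = x , refl , halved-residue {x} q

-- The two chains of bijections and their meeting point.

-- The charge forms are 2c² - c for residues 1, 3 modulo 4 and 4k² - k for residues 3, 5 modulo 8.
-- At c = 2k the first is twice the second, which links the two sides.
module J₄ = TripleProduct 2 1 3 refl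
module J₈ = TripleProduct 4 3 5 refl

open SetoidReasoning ≃-setoid

G-side : partitions GResidue ≃ J₈.charges ⊗ gaps 2 0 2
G-side = begin
  partitions GResidue
    ≈⟨ G-split ⟩
  partitions (Residue 8 (3 ∷ 5 ∷ [])) ⊗ R
    ≈⟨ ⊗-cong partitions-pairOff ≃-refl ⟩
  (distinct (Residue 8 (3 ∷ 5 ∷ [])) ⊗ double (partitions (Residue 8 (3 ∷ 5 ∷ [])))) ⊗ R
    ≈⟨ ⊗-assoc ⟩
  distinct (Residue 8 (3 ∷ 5 ∷ [])) ⊗ (double (partitions (Residue 8 (3 ∷ 5 ∷ []))) ⊗ R)
    ≈⟨ ⊗-cong ±3-split (≃-trans (⊗-cong ±3-double ≃-refl) (≃-sym Q-split)) ⟩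
  (distinct (Residue 8 (3 ∷ [])) ⊗ distinct (Residue 8 (5 ∷ []))) ⊗ Q
    ≈⟨ ⊗-cong (⊗-cong (distinct≃gaps 8 3 (from-yes (3 <? 8))) (distinct≃gaps 8 5 (from-yes (5 <? 8)))) ≃-refl ⟩
  (gaps 8 1 3 ⊗ gaps 8 1 5) ⊗ Q
    ≈⟨ ⊗-cong J₈.tripleProduct ≃-refl ⟩
  (J₈.charges ⊗ gaps 8 0 8) ⊗ Q
    ≈⟨ ⊗-assoc ⟩
  J₈.charges ⊗ (gaps 8 0 8 ⊗ Q)
    ≈⟨ ⊗-cong ≃-refl (⊗-cong (≃-sym (partitions≃gaps 8)) ≃-refl) ⟩
  J₈.charges ⊗ (partitions (Multiple⁺ 8) ⊗ Q)
    ≈⟨ ⊗-cong ≃-refl (≃-trans (≃-sym even-split) (partitions≃gaps 2)) ⟩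
  J₈.charges ⊗ gaps 2 0 2 ∎
  where
  R = partitions (Residue 16 (2 ∷ 4 ∷ 12 ∷ 14 ∷ []))
  Q = partitions (Residue 8 (2 ∷ 4 ∷ 6 ∷ []))

halve : ℤ → ℤ
halve (+ n)    = + (n / 2)
-- If n + 1 = 2k with k ≥ 1, then n / 2 = k - 1, so the result is -k.
halve -[1+ n ] = -[1+ n / 2 ]

halve-double : ∀ k → halve (+ 2 ℤ.* k) ≡ k
halve-double (+ n)    = trans (cong halve (sym (ℤ.pos-* 2 n)))
  (cong +_ (trans (cong (_/ 2) (ℕ.*-comm 2 n)) (m*n/n≡m n 2)))
halve-double -[1+ n ] = cong -[1+_] (trans
  (cong (_/ 2) (solve 1 (λ n → n :+ (con 1 :+ (n :+ con 0)) := con 1 :+ n :* con 2) refl n))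
  (trans (+-distrib-/-∣ʳ 1 {n * 2} {2} (n∣m*n n)) (m*n/n≡m n 2)))
  where open +-*-Solver

-- The same gap list is read with step 4 and with step 2, so `even-charges` halves the weight
-- without changing the list.
sum-decode-double : ∀ c L → sum (Gaps.decode 4 0 (2 * c) L) ≡ 2 * sum (Gaps.decode 2 0 c L)
sum-decode-double c []      = refl
sum-decode-double c (g ∷ L) = trans
  (cong₂ _+_ (scale c g)
    (trans (cong (λ z → sum (Gaps.decode 4 0 z L)) (scale c (g + 0))) (sum-decode-double (c + 2 * (g + 0)) L)))
  (sym (ℕ.*-distribˡ-+ 2 (c + 2 * g) _))
  where
  open +-*-Solver
  scale : ∀ c g → 2 * c + 4 * g ≡ 2 * (c + 2 * g)
  scale = solve 2 (λ c g → con 2 :* c :+ con 4 :* g := con 2 :* (c :+ con 2 :* g)) refl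

even-charges : evenPart (J₄.charges ⊗ gaps 4 0 4) ≃ double (J₈.charges ⊗ gaps 2 0 2)
even-charges = record
  { to      = λ (c , L) → halve c , L
  ; from    = λ (k , L) → + 2 ℤ.* k , L
  ; to-ok   = _
  ; from-ok = λ {(k , L)} _ → _ , _ , weight k L
  ; from-to = λ {(c , L)} (_ , k , eq) → cong (_, L) (trans (cong (λ z → + 2 ℤ.* halve z) (even-charge c L k eq))
                 (trans (cong (+ 2 ℤ.*_) (halve-double _)) (sym (even-charge c L k eq))))
  ; to-from = λ {(k , L)} _ → cong (_, L) (halve-double k)
  ; wt-to   = λ {(c , L)} (_ , k , eq) → subst
       (λ z → + 2 ℤ.* (J₈.quadratic (halve z) ℤ.+ s L) ≡ J₄.quadratic z ℤ.+ + sum (Gaps.decode 4 0 4 L))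
       (sym (even-charge c L k eq))
       (trans (cong (λ z → + 2 ℤ.* (J₈.quadratic z ℤ.+ s L)) (halve-double (root c L k))) (sym (weight (root c L k) L))) }
  where
  s : List ℕ → ℤ
  s L = + sum (Gaps.decode 2 0 2 L)

  -- Half of c, found by solving 2c² - c + 2s = 2k for c. This yields the evenness of c without a
  -- case distinction.
  root : ℤ → List ℕ → ℤ → ℤ
  root c L k = c ℤ.* c ℤ.+ s L ℤ.- k

  s₄ : ∀ L → + sum (Gaps.decode 4 0 4 L) ≡ + 2 ℤ.* s L
  s₄ L = trans (cong +_ (sum-decode-double 2 L)) (ℤ.pos-* 2 (sum (Gaps.decode 2 0 2 L)))

  even-charge : ∀ c L k → J₄.quadratic c ℤ.+ + sum (Gaps.decode 4 0 4 L) ≡ + 2 ℤ.* k → c ≡ + 2 ℤ.* root c L k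
  even-charge c L k eq = trans (rearrange c (s L))
    (trans (cong (λ z → + 2 ℤ.* (c ℤ.* c ℤ.+ s L) ℤ.- z) (trans (cong (ℤ._+_ (J₄.quadratic c)) (sym (s₄ L))) eq))
           (factor (c ℤ.* c ℤ.+ s L) k))
    where
    rearrange : ∀ c s → c ≡ + 2 ℤ.* (c ℤ.* c ℤ.+ s) ℤ.- (+ 2 ℤ.* c ℤ.* c ℤ.+ (+ 1 ℤ.- + 2) ℤ.* c ℤ.+ + 2 ℤ.* s)
    rearrange = solve-∀
    factor : ∀ x k → + 2 ℤ.* x ℤ.- + 2 ℤ.* k ≡ + 2 ℤ.* (x ℤ.- k)
    factor = solve-∀

  weight : ∀ k L → J₄.quadratic (+ 2 ℤ.* k) ℤ.+ + sum (Gaps.decode 4 0 4 L) ≡ + 2 ℤ.* (J₈.quadratic k ℤ.+ s L)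
  weight k L = trans (cong (ℤ._+_ (J₄.quadratic (+ 2 ℤ.* k))) (s₄ L)) (eq k (s L))
    where
    eq : ∀ k s → + 2 ℤ.* (+ 2 ℤ.* k) ℤ.* (+ 2 ℤ.* k) ℤ.+ (+ 1 ℤ.- + 2) ℤ.* (+ 2 ℤ.* k) ℤ.+ + 2 ℤ.* s
               ≡ + 2 ℤ.* (+ 4 ℤ.* k ℤ.* k ℤ.+ (+ 3 ℤ.- + 4) ℤ.* k ℤ.+ s)
    eq = solve-∀

H-side : double copyPartitions ≃ double (J₈.charges ⊗ gaps 2 0 2)
H-side = begin
  double copyPartitions
    ≈⟨ copyPartitions≃odds ⟩
  evenPart (distinct (Progression 2 1))
    ≈⟨ evenPart-cong (begin
         distinct (Progression 2 1)
           ≈⟨ listing-⇔ (progression⇒residue 2 1 (from-yes (1 <? 2))) (residue⇒progression 2 1) ⟩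
         distinct (Residue 2 (1 ∷ []))
           ≈⟨ odd-split ⟩
         distinct (Residue 4 (1 ∷ [])) ⊗ distinct (Residue 4 (3 ∷ []))
           ≈⟨ ⊗-cong (distinct≃gaps 4 1 (from-yes (1 <? 4))) (distinct≃gaps 4 3 (from-yes (3 <? 4))) ⟩
         gaps 4 1 1 ⊗ gaps 4 1 3
           ≈⟨ J₄.tripleProduct ⟩
         J₄.charges ⊗ gaps 4 0 4 ∎) ⟩
  evenPart (J₄.charges ⊗ gaps 4 0 4)
    ≈⟨ even-charges ⟩
  double (J₈.charges ⊗ gaps 2 0 2) ∎

-- Agreement with the stated definitions of G and H.

Any± : Pred ℕ 0ℓ
Any± k = Any (λ r → k ≡± r [mod 16 ]) (2 ∷ 3 ∷ 4 ∷ 5 ∷ [])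

module _ {k : ℕ} {z : ℤ} where
  private
    shifted : + (16 + k) ℤ.- z ≡ + 16 ℤ.+ (+ k ℤ.- z)
    shifted = trans (cong (ℤ._- z) (ℤ.pos-+ 16 k)) (ℤ.+-assoc (+ 16) (+ k) (ℤ.- z))

  -- The congruence is divisibility of absolute values, which are not additive; the sum is formed in
  -- signed divisibility.
  ≡-shift : (+ k) ≡ z [mod 16 ] → + (16 + k) ≡ z [mod 16 ]
  ≡-shift p = Signed.∣⇒∣ᵤ (subst (Signed._∣_ (+ 16)) (sym shifted)
    (Signed.∣m∣n⇒∣m+n Signed.∣-refl (Signed.∣ᵤ⇒∣ {+ 16} {+ k ℤ.- z} p)))

  ≡-unshift : + (16 + k) ≡ z [mod 16 ] → (+ k) ≡ z [mod 16 ]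
  ≡-unshift p = Signed.∣⇒∣ᵤ {+ 16} {+ k ℤ.- z} (Signed.∣m+n∣m⇒∣n
    (subst (Signed._∣_ (+ 16)) shifted (Signed.∣ᵤ⇒∣ {+ 16} {+ (16 + k) ℤ.- z} p)) Signed.∣-refl)

Any±⇔GResidue : ∀ k → (Any± k → GResidue k) × (GResidue k → Any± k)
Any±⇔GResidue = mod16-induction step (from-yes (all? agree? (upTo 16)))
  where
  step : ∀ k → (Any± k → GResidue k) × (GResidue k → Any± k) →
         (Any± (16 + k) → GResidue (16 + k)) × (GResidue (16 + k) → Any± (16 + k))
  step k (f , g) = 
    f ∘ Any.map (λ {r} → Sum.map (≡-unshift {k} {+ r}) (≡-unshift {k} {ℤ.- + r})) ,
    Any.map (λ {r} → Sum.map (≡-shift {k} {+ r}) (≡-shift {k} {ℤ.- + r})) ∘ g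

  any±? : Decidable Any±
  any±? k = Any.any? (λ r → (_ ∣? _) ⊎-dec (_ ∣? _)) _

  agree? : Decidable (λ k → (Any± k → GResidue k) × (GResidue k → Any± k))
  agree? k = (any±? k →-dec residue? _ _ k) ×-dec (residue? _ _ k →-dec any±? k)

-- Restores the positivity that `IsPartition` records and `partitions GResidue` leaves implicit in
-- the residues.
GResidue⇒positive : ∀ {k} → GResidue k → 1 ≤ k
GResidue⇒positive {zero}  p = contradiction p (from-no (residue? 16 gResidues 0))
GResidue⇒positive {suc k} _ = s≤s z≤n

reenumerate : ∀ {A : Set} {P Q : Pred A 0ℓ} → (∀ {x} → P x → Q x) → (∀ {x} → Q x → P x) → Enumeration P → Enumeration Q
reenumerate P⇒Q Q⇒P E = record
  { elements = elements
  ; unique   = unique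
  ; exact    = λ x → mk⇔ (P⇒Q ∘ Equivalence.to (exact x)) (Equivalence.from (exact x) ∘ Q⇒P) }
  where open Enumeration E

doubled-total : ∀ {m n} → m ≡ n → + 2 ℤ.* + m ≡ + 2 ℤ.* + n
doubled-total refl = refl

halved-total : ∀ {m n} → + 2 ℤ.* + m ≡ + 2 ℤ.* + n → m ≡ n
halved-total eq = ℤ.+-injective (ℤ.*-cancelˡ-≡ (+ 2) _ _ eq)

-- The weight is 2n in the doubled class so that this side is comparable with `H-side`, where
-- pairing produces the factor 2.
gFibre : ∀ n → Enumeration (fibre (double (partitions GResidue)) (+ 2 ℤ.* + n))
gFibre n = reenumerate
  (λ (mkGPartition (mkPartition _ s t) rs) →
     (Linked⇒AllPairs ℕ.≤-trans s , All.map (λ {k} → proj₁ (Any±⇔GResidue k)) rs) , doubled-total t)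
  (λ ((s , rs) , t) → mkGPartition (mkPartition (All.map GResidue⇒positive rs) (AllPairs⇒Linked s) (halved-total t))
                                   (All.map (λ {k} → proj₂ (Any±⇔GResidue k)) rs))
  (gPartitions n)

hFibre : ∀ n → Enumeration (fibre (double copyPartitions) (+ 2 ℤ.* + n))
hFibre n = reenumerate
  (λ (mkHPartition (mkCopyPartition inM s t) es ds zs) →
     (All.zip (inM , es) , Linked.zip (s , Linked.zip (ds , zs))) , doubled-total t)
  (λ ((gs , fs) , t) →
     let (s , dz) = Linked.unzip fs ; (ds , zs) = Linked.unzip dz ; (inM , es) = All.unzip gs in
     mkHPartition (mkCopyPartition inM s (halved-total t)) es ds zs)
  (hPartitions n)

theorem31 : (n : ℕ) → n ≥ 1 → G n ≡ H n
theorem31 n _ = ≃⇒count≡ (≃-trans (double-cong G-side) (≃-sym H-side)) (gFibre n) (hFibre n)
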